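{- Fix a positive integer $k$ and $\delta > 0$. For every $\epsilon > 0$ there exists $M$ (depending only on $k, \delta, \epsilon$) such that the following holds. Let $n$ be a positive integer and let $\mathcal{G}$ be a family of subsets of $[n]=\{1,\ldots,n\}$ with $|\mathcal{G}| = m$, where $m \geq M$ and $m \geq 2^{\left(\frac{1}{k+1}+\delta\right)n}$. Then the number of unordered $k$-tuples $\{A_1,\ldots,A_k\}$ of $k$ distinct members of $\mathcal{G}$ that are pairwise disjoint is at most \[\left(\frac{k!}{k^{k}}+\epsilon\right)\binom{m}{k}.\]
   Context: $\mathbb{P}[n]$ denotes the power set of $[n]=\{1,\ldots,n\}$, and $\mathcal{G} \subset \mathbb{P}[n]$. Sets $A_1,\ldots,A_k$ are pairwise disjoint if $A_i \cap A_j = \emptyset$ for all $i \neq j$. -}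

module Defs where

open import Data.Nat using (ℕ; zero; suc)
open import Data.List using (List; []; _∷_; map; _++_; length; filter)
open import Data.List.Relation.Unary.AllPairs using (AllPairs)
open import Data.List.Relation.Unary.AllPairs.Properties using ()
import Data.List.Relation.Unary.AllPairs as AP
open import Data.Fin.Subset using (Subset; _∩_; Empty)
open import Data.Fin.Subset.Properties using (nonempty?)
open import Relation.Nullary using (Dec; ¬?)
open import Relation.Binary using (Decidable)

Disjoint : ∀ {n} → Subset n → Subset n → Set
Disjoint p q = Empty (p ∩ q)

disjoint? : ∀ {n} → Decidable (Disjoint {n})
disjoint? p q = ¬? (nonempty? (p ∩ q))

-- All k-element sub-lists of a list (choices of k positions, order preserved).
-- For a list without duplicates these correspond exactly to the k-element subsets.
combinations : ∀ {a} {A : Set a} → ℕ → List A → List (List A)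
combinations zero    _        = [] ∷ []
combinations (suc k) []       = []
combinations (suc k) (x ∷ xs) = map (x ∷_) (combinations k xs) ++ combinations (suc k) xs

-- Number of unordered k-tuples {A₁,…,Aₖ} of distinct members of the family G
-- (given as a duplicate-free list) that are pairwise disjoint.
disjointTuples : ∀ {n} → ℕ → List (Subset n) → ℕ
disjointTuples k G = length (filter (AP.allPairs? disjoint?) (combinations k G))

{-# OPTIONS --safe #-}
module Submission where

open import Defs
open import Data.Nat using (ℕ; suc; _+_; _*_; _^_; _≤_)
open import Data.Nat using (_!)
open import Data.Nat.Combinatorics using (_C_)
open import Data.List using (List; length)
open import Data.List.Relation.Unary.Unique.Propositional using (Unique)
open import Data.Fin.Subset using (Subset)
open import Data.Product using (Σ; _×_)
open import Data.Bool.Properties using (not-involutive)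
open import Data.Fin using (zero; suc)
open import Data.Fin.Subset using (inside; outside; _∪_; ∁; ∣_∣)
open import Data.Fin.Subset.Properties using (∣p∣≤n)
open import Data.List using ([]; _∷_; _++_; map; filter; cartesianProductWith)
open import Data.List.Membership.Propositional using (_∈_)
open import Data.List.Membership.Propositional.Properties
  using (∈-cartesianProductWith⁺; ∈-∃++; ∈-++⁻; ∈-++⁺ˡ; ∈-++⁺ʳ)
open import Data.List.Properties using (map-++; map-∘)
open import Data.List.Relation.Unary.All as All using (All; []; _∷_)
open import Data.List.Relation.Unary.All.Properties using (cartesianProductWith⁺)
open import Data.List.Relation.Unary.AllPairs as AllPairs using (AllPairs; []; _∷_)
open import Data.List.Relation.Unary.Any using (here; there)
open import Data.Nat using (zero; _∸_; _/_; _<_; _≤?_; z≤n; s≤s; NonZero; >-nonZero; ≢-nonZero⁻¹)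
open import Data.Nat.Combinatorics using (nCk+nC[k+1]≡[n+1]C[k+1]; nC1≡n)
open import Data.Nat.DivMod using (m/n*n≤m; m*n/n≡m; /-monoˡ-≤)
open import Data.Nat.ListAction using (sum; product)
open import Data.Nat.ListAction.Properties using (sum-++)
open import Data.Nat.Properties
open import Data.Nat.Tactic.RingSolver using (solve-∀)
open import Data.Product using (_,_)
open import Data.Sum using (inj₁; inj₂)
open import Data.Vec using ([]; _∷_; here; there)
open import Function using (_∘_)
open import Relation.Binary.PropositionalEquality
  using (_≡_; refl; sym; trans; cong; cong₂; subst; subst₂; setoid; module ≡-Reasoning)
open import Relation.Nullary using (Dec; yes; no; contradiction)
open import Relation.Unary using (Decidable)

-- For a list L of sets let T s be the number of s-tuples from L that are pairwise disjoint.
-- A positive density of (k+1)-cliques in the disjointness relation would, by the power mean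
-- inequality applied in one coordinate at a time, give a positive density of cliques among
-- the unions of t members.  In such a clique of unions one union has at most n/(k+1) elements,
-- and since m ≥ 2^((1/(k+1)+δ)n) at most a 1/m fraction of the t-fold unions is that small.
-- Hence T (k+1) = o(m^(k+1)).  The Moon–Moser inequalities
--   s (T s)² ≤ T (s-1) ((s-1) T (s+1) + m T s)
-- then propagate T (k+1) ≈ 0 down to T s / T (s-1) ≲ m (k+1-s)/k for all s ≤ k, whose product
-- is T k ≲ (k!/k^k) m^k.

-- Pigeonhole in `G` itself gives nothing: every member of `G` may have at most n/(k+1) elements,
-- since far more than 2^(n/(k+1)) sets are that small. Taking unions beats this entropy. A fixed
-- set of n/(k+1) elements contains at most 2^(n/(k+1)) members of `G`, a fraction at most 2^(-δn)
-- of them. For t members these fractions multiply, whereas choosing the small set around the union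
-- costs a factor 2^n only once. With δ = a/b, the choice t = 2b leaves 2^(-n) ≤ 1/m. Since t does
-- not depend on n, a clique density 1/H in `G` survives among the unions as a positive constant,
-- which is absurd once m is large. The constant k!/k^k is the ordered k-clique density of the
-- balanced complete k-partite graph, which is extremal without (k+1)-cliques; Moon-Moser tolerates
-- a few such cliques. All inequalities are multiplied out so that they live in ℕ, and the errors
-- are ratios 1 + 1/Q and 1 + k/D with explicit `Q` and `D`.

private variable
  A B A′ : Set

-- Finite sums over lists

∑ : List A → (A → ℕ) → ℕ
∑ xs f = sum (map f xs)

infix 2 ∑
syntax ∑ xs (λ x → e) = ∑[ x ∈ xs ] e

∑-mono : {f g : A → ℕ} → (∀ x → f x ≤ g x) → ∀ xs → ∑ xs f ≤ ∑ xs g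
∑-mono f≤g []       = z≤n
∑-mono f≤g (x ∷ xs) = +-mono-≤ (f≤g x) (∑-mono f≤g xs)

∑-cong : {f g : A → ℕ} → (∀ x → f x ≡ g x) → ∀ xs → ∑ xs f ≡ ∑ xs g
∑-cong f≡g []       = refl
∑-cong f≡g (x ∷ xs) = cong₂ _+_ (f≡g x) (∑-cong f≡g xs)

∑-distribˡ : ∀ c (f : A → ℕ) xs → ∑ xs (λ x → c * f x) ≡ c * ∑ xs f
∑-distribˡ c f []       = sym (*-zeroʳ c)
∑-distribˡ c f (x ∷ xs) = trans (cong (c * f x +_) (∑-distribˡ c f xs)) (sym (*-distribˡ-+ c (f x) _))

∑-distribʳ : ∀ c (f : A → ℕ) xs → ∑ xs (λ x → f x * c) ≡ ∑ xs f * c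
∑-distribʳ c f xs = trans (∑-cong (λ x → *-comm (f x) c) xs) (trans (∑-distribˡ c f xs) (*-comm c _))

∑-distrib-+ : ∀ (f g : A → ℕ) xs → ∑ xs (λ x → f x + g x) ≡ ∑ xs f + ∑ xs g
∑-distrib-+ f g []       = refl
∑-distrib-+ f g (x ∷ xs) = trans (cong (f x + g x +_) (∑-distrib-+ f g xs)) (interchange (f x) (g x) _ _)
  where
  interchange : ∀ a b c d → a + b + (c + d) ≡ a + c + (b + d)
  interchange = solve-∀

∑-const : ∀ c (xs : List A) → ∑ xs (λ _ → c) ≡ length xs * c
∑-const c []       = refl
∑-const c (x ∷ xs) = cong (c +_) (∑-const c xs)

∑-++ : ∀ (f : A → ℕ) xs ys → ∑ (xs ++ ys) f ≡ ∑ xs f + ∑ ys f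
∑-++ f xs ys = trans (cong sum (map-++ f xs ys)) (sum-++ (map f xs) (map f ys))

∑-map : ∀ (f : B → ℕ) (h : A → B) xs → ∑ (map h xs) f ≡ ∑ xs (f ∘ h)
∑-map f h xs = cong sum (sym (map-∘ xs))

∑-cartesianProductWith : ∀ (f : A′ → ℕ) (h : A → B → A′) xs ys →
  ∑ (cartesianProductWith h xs ys) f ≡ (∑[ x ∈ xs ] ∑[ y ∈ ys ] f (h x y))
∑-cartesianProductWith f h []       ys = refl
∑-cartesianProductWith f h (x ∷ xs) ys = trans (∑-++ f (map (h x) ys) _)
  (cong₂ _+_ (∑-map f (h x) ys) (∑-cartesianProductWith f h xs ys))

∑-swap : ∀ (f : A → B → ℕ) xs ys →
  (∑[ x ∈ xs ] ∑[ y ∈ ys ] f x y) ≡ (∑[ y ∈ ys ] ∑[ x ∈ xs ] f x y)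
∑-swap f []       ys = sym (trans (∑-const 0 ys) (*-zeroʳ (length ys)))
∑-swap f (x ∷ xs) ys = trans (cong (∑ ys (f x) +_) (∑-swap f xs ys)) (sym (∑-distrib-+ (f x) _ ys))

∑-*-∑ : ∀ (f : A → ℕ) (g : B → ℕ) xs ys →
  ∑ xs f * ∑ ys g ≡ (∑[ x ∈ xs ] ∑[ y ∈ ys ] f x * g y)
∑-*-∑ f g xs ys = sym (trans (∑-cong (λ x → ∑-distribˡ (f x) g ys) xs) (∑-distribʳ (∑ ys g) f xs))

∑∑-mono : {F G : A → B → ℕ} → (∀ x y → F x y ≤ G x y) → ∀ xs ys →
  (∑[ x ∈ xs ] ∑[ y ∈ ys ] F x y) ≤ (∑[ x ∈ xs ] ∑[ y ∈ ys ] G x y)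
∑∑-mono F≤G xs ys = ∑-mono (λ x → ∑-mono (F≤G x) ys) xs

∑∑-distrib-+ : ∀ (F G : A → B → ℕ) xs ys →
  (∑[ x ∈ xs ] ∑[ y ∈ ys ] F x y + G x y) ≡ (∑[ x ∈ xs ] ∑[ y ∈ ys ] F x y) + (∑[ x ∈ xs ] ∑[ y ∈ ys ] G x y)
∑∑-distrib-+ F G xs ys = trans (∑-cong (λ x → ∑-distrib-+ (F x) (G x) ys) xs) (∑-distrib-+ _ _ xs)

-- Exchanging x and y does not change a double sum over a square, so it is enough to compare the
-- symmetrised summands.
∑∑-mono-sym : {F G : A → A → ℕ} → (∀ x y → F x y + F y x ≤ G x y + G y x) → ∀ xs →
  (∑[ x ∈ xs ] ∑[ y ∈ xs ] F x y) ≤ (∑[ x ∈ xs ] ∑[ y ∈ xs ] G x y)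
∑∑-mono-sym {F = F} {G} F≤G xs = *-cancelˡ-≤ 2 (begin
  2 * total F                                 ≡⟨ double F ⟩
  (∑[ x ∈ xs ] ∑[ y ∈ xs ] F x y + F y x)     ≤⟨ ∑∑-mono F≤G xs xs ⟩
  (∑[ x ∈ xs ] ∑[ y ∈ xs ] G x y + G y x)     ≡⟨ double G ⟨
  2 * total G                                 ∎)
  where
  open ≤-Reasoning
  total : (_ → _ → ℕ) → ℕ
  total H = ∑[ x ∈ xs ] ∑[ y ∈ xs ] H x y
  double : ∀ H → 2 * total H ≡ (∑[ x ∈ xs ] ∑[ y ∈ xs ] H x y + H y x)
  double H = trans (cong (total H +_) (trans (+-identityʳ _) (∑-swap H xs xs)))
                   (sym (∑∑-distrib-+ H (λ x y → H y x) xs xs))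

-- Rearrangement, Chebyshev and power mean inequalities

-- The difference of the two sides is (b^t - a^t)(b - a); writing b = a + e avoids the subtraction.
rearrangement-≤ : ∀ t {a b} → a ≤ b → a ^ t * b + b ^ t * a ≤ a ^ t * a + b ^ t * b
rearrangement-≤ t {a} a≤b with e , refl ← m≤n⇒∃[o]m+o≡n a≤b = begin
  a ^ t * (a + e) + p * a       ≡⟨ expand (a ^ t) p a e ⟩
  a ^ t * a + p * a + a ^ t * e ≤⟨ +-monoʳ-≤ (a ^ t * a + p * a) (*-monoˡ-≤ e (^-monoˡ-≤ t (m≤m+n a e))) ⟩
  a ^ t * a + p * a + p * e     ≡⟨ collect (a ^ t) p a e ⟩
  a ^ t * a + p * (a + e)       ∎
  where
  open ≤-Reasoning
  p = (a + e) ^ t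
  expand : ∀ q p a e → q * (a + e) + p * a ≡ q * a + p * a + q * e
  expand = solve-∀
  collect : ∀ q p a e → q * a + p * a + p * e ≡ q * a + p * (a + e)
  collect = solve-∀

rearrangement : ∀ t a b → a ^ t * b + b ^ t * a ≤ a ^ t * a + b ^ t * b
rearrangement t a b with ≤-total a b
... | inj₁ a≤b = rearrangement-≤ t a≤b
... | inj₂ b≤a = subst₂ _≤_ (+-comm (b ^ t * a) _) (+-comm (b ^ t * b) _) (rearrangement-≤ t b≤a)

-- Chebyshev's sum inequality with weights c: the functions d^t and d are ordered alike, so each
-- symmetrised pair is an instance of `rearrangement`.
chebyshev : ∀ t (c d : A → ℕ) xs →
  (∑[ x ∈ xs ] c x * d x ^ t) * (∑[ x ∈ xs ] c x * d x) ≤ ∑ xs c * (∑[ x ∈ xs ] c x * d x ^ suc t)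
chebyshev t c d xs = begin
  (∑[ x ∈ xs ] c x * d x ^ t) * (∑[ x ∈ xs ] c x * d x)     ≡⟨ ∑-*-∑ _ _ xs xs ⟩
  (∑[ x ∈ xs ] ∑[ y ∈ xs ] c x * d x ^ t * (c y * d y))     ≤⟨ ∑∑-mono-sym pointwise xs ⟩
  (∑[ x ∈ xs ] ∑[ y ∈ xs ] c x * (c y * d y ^ suc t))       ≡⟨ ∑-*-∑ _ _ xs xs ⟨
  ∑ xs c * (∑[ x ∈ xs ] c x * d x ^ suc t)                  ∎
  where
  open ≤-Reasoning
  before : ∀ u v a b p q → u * p * (v * b) + v * q * (u * a) ≡ u * v * (p * b + q * a)
  before = solve-∀
  after : ∀ u v a b p q → u * v * (p * a + q * b) ≡ u * (v * (b * q)) + v * (u * (a * p))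
  after = solve-∀
  pointwise : ∀ x y → c x * d x ^ t * (c y * d y) + c y * d y ^ t * (c x * d x)
                    ≤ c x * (c y * d y ^ suc t) + c y * (c x * d x ^ suc t)
  pointwise x y = begin
    _ ≡⟨ before (c x) (c y) (d x) (d y) (d x ^ t) (d y ^ t) ⟩
    c x * c y * (d x ^ t * d y + d y ^ t * d x) ≤⟨ *-monoʳ-≤ (c x * c y) (rearrangement t (d x) (d y)) ⟩
    c x * c y * (d x ^ t * d x + d y ^ t * d y) ≡⟨ after (c x) (c y) (d x) (d y) (d x ^ t) (d y ^ t) ⟩
    _ ∎

power-mean : ∀ t (c d : A → ℕ) xs →
  (∑[ x ∈ xs ] c x * d x) ^ suc t ≤ ∑ xs c ^ t * (∑[ x ∈ xs ] c x * d x ^ suc t)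
power-mean zero c d xs = ≤-reflexive (begin
  (∑[ x ∈ xs ] c x * d x) * 1       ≡⟨ *-identityʳ _ ⟩
  (∑[ x ∈ xs ] c x * d x)           ≡⟨ ∑-cong (λ x → cong (c x *_) (sym (*-identityʳ (d x)))) xs ⟩
  (∑[ x ∈ xs ] c x * (d x * 1))     ≡⟨ *-identityˡ _ ⟨
  1 * (∑[ x ∈ xs ] c x * (d x * 1)) ∎)
  where open ≡-Reasoning
power-mean (suc t) c d xs = begin
  μ * μ ^ suc t                                         ≤⟨ *-monoʳ-≤ μ (power-mean t c d xs) ⟩
  μ * (n ^ t * (∑[ x ∈ xs ] c x * d x ^ suc t))         ≡⟨ shuffle₁ μ (n ^ t) _ ⟩
  n ^ t * ((∑[ x ∈ xs ] c x * d x ^ suc t) * μ)         ≤⟨ *-monoʳ-≤ (n ^ t) (chebyshev (suc t) c d xs) ⟩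
  n ^ t * (n * (∑[ x ∈ xs ] c x * d x ^ suc (suc t)))   ≡⟨ shuffle₂ (n ^ t) n _ ⟩
  n * n ^ t * (∑[ x ∈ xs ] c x * d x ^ suc (suc t))     ∎
  where
  open ≤-Reasoning
  μ = ∑[ x ∈ xs ] c x * d x
  n = ∑ xs c
  shuffle₁ : ∀ a b c → a * (b * c) ≡ b * (c * a)
  shuffle₁ = solve-∀
  shuffle₂ : ∀ a b c → a * (b * c) ≡ b * a * c
  shuffle₂ = solve-∀

-- The factor `length xs` on the left raises the exponent t on the right to t + 1 = e. Thus e need
-- not be a visible successor, and it can later be a power such as `τ ^ s`.
power-mean-uniform : ∀ e → NonZero e → ∀ (d : A → ℕ) xs →
  ∑ xs d ^ e * length xs ≤ length xs ^ e * (∑[ x ∈ xs ] d x ^ e)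
power-mean-uniform (suc t) _ d xs = begin
  ∑ xs d ^ suc t * n
    ≡⟨ cong (λ μ → μ ^ suc t * n) (∑-cong (λ x → sym (*-identityˡ (d x))) xs) ⟩
  (∑[ x ∈ xs ] 1 * d x) ^ suc t * n
    ≤⟨ *-monoˡ-≤ n (power-mean t (λ _ → 1) d xs) ⟩
  ∑ xs (λ _ → 1) ^ t * (∑[ x ∈ xs ] 1 * d x ^ suc t) * n
    ≡⟨ cong₂ (λ p q → p ^ t * q * n) (trans (∑-const 1 xs) (*-identityʳ n)) (∑-cong (λ x → *-identityˡ _) xs) ⟩
  n ^ t * (∑[ x ∈ xs ] d x ^ suc t) * n
    ≡⟨ shuffle (n ^ t) _ n ⟩
  n * n ^ t * (∑[ x ∈ xs ] d x ^ suc t) ∎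
  where
  open ≤-Reasoning
  n = length xs
  shuffle : ∀ a b c → a * b * c ≡ c * a * b
  shuffle = solve-∀

-- Tuples and iterated products of list entries

^-distribʳ-* : ∀ n a b → (a * b) ^ n ≡ a ^ n * b ^ n
^-distribʳ-* zero    a b = refl
^-distribʳ-* (suc n) a b = trans (cong (a * b *_) (^-distribʳ-* n a b)) ([m*n]*[o*p]≡[m*o]*[n*p] a b (a ^ n) (b ^ n))

0-1-power : ∀ {a} e → NonZero e → a ≤ 1 → a ^ e ≤ a
0-1-power {a} (suc e) _ a≤1 = begin
  a * a ^ e   ≤⟨ *-monoʳ-≤ a (^-monoˡ-≤ e a≤1) ⟩
  a * 1 ^ e   ≡⟨ trans (cong (a *_) (^-zeroˡ e)) (*-identityʳ a) ⟩
  a           ∎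
  where open ≤-Reasoning

tuples : ℕ → List A → List (List A)
tuples zero    L = [] ∷ []
tuples (suc s) L = cartesianProductWith _∷_ L (tuples s L)

length-cartesianProductWith : ∀ (h : A → B → A′) xs ys → length (cartesianProductWith h xs ys) ≡ length xs * length ys
length-cartesianProductWith h xs ys = begin
  length (cartesianProductWith h xs ys)   ≡⟨ trans (sym (*-identityʳ _)) (sym (∑-const 1 (cartesianProductWith h xs ys))) ⟩
  ∑ (cartesianProductWith h xs ys) (λ _ → 1)  ≡⟨ ∑-cartesianProductWith _ h xs ys ⟩
  (∑[ x ∈ xs ] ∑[ y ∈ ys ] 1)   ≡⟨ trans (∑-const _ xs) (cong (length xs *_) (trans (∑-const 1 ys) (*-identityʳ _))) ⟩
  length xs * length ys  ∎
  where open ≡-Reasoning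

length-tuples : ∀ s (L : List A) → length (tuples s L) ≡ length L ^ s
length-tuples zero    L = refl
length-tuples (suc s) L = trans (length-cartesianProductWith _∷_ L (tuples s L)) (cong (length L *_) (length-tuples s L))

-- products _∙_ t L lists the products of t + 1 factors, so that no unit is needed.
products : (A → A → A) → ℕ → List A → List A
products _∙_ zero    L = L
products _∙_ (suc t) L = cartesianProductWith _∙_ L (products _∙_ t L)

length-products : ∀ (_∙_ : A → A → A) t L → length (products _∙_ t L) ≡ length L ^ suc t
length-products _∙_ zero    L = sym (*-identityʳ _)
length-products _∙_ (suc t) L = trans (length-cartesianProductWith _∙_ L (products _∙_ t L))
                                      (cong (length L *_) (length-products _∙_ t L))

-- Each of the s positions takes every value equally often. The factor `length L` on the left avoids
-- the exponent s - 1.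
∑-entries : ∀ (f : A → ℕ) s L →
  length L * (∑[ z ∈ tuples s L ] ∑ z f) ≡ s * length L ^ s * ∑ L f
∑-entries f zero    L = *-zeroʳ (length L)
∑-entries f (suc s) L = begin
  n * (∑[ z ∈ tuples (suc s) L ] ∑ z f)
    ≡⟨ cong (n *_) (∑-cartesianProductWith (λ z → ∑ z f) _∷_ L (tuples s L)) ⟩
  n * (∑[ x ∈ L ] ∑[ z ∈ tuples s L ] f x + ∑ z f)
    ≡⟨ cong (n *_) (trans (∑∑-distrib-+ (λ x _ → f x) (λ _ z → ∑ z f) L (tuples s L))
                          (cong₂ _+_ (∑-cong (λ x → ∑-const (f x) (tuples s L)) L) (∑-const _ L))) ⟩
  n * ((∑[ x ∈ L ] length (tuples s L) * f x) + n * S)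
    ≡⟨ cong (λ u → n * (u + n * S)) (trans (∑-distribˡ (length (tuples s L)) f L) (cong (_* ∑ L f) (length-tuples s L))) ⟩
  n * (n ^ s * ∑ L f + n * S)
    ≡⟨ cong (λ u → n * (n ^ s * ∑ L f + u)) (∑-entries f s L) ⟩
  n * (n ^ s * ∑ L f + s * n ^ s * ∑ L f)
    ≡⟨ collect n (n ^ s) s (∑ L f) ⟩
  suc s * n ^ suc s * ∑ L f ∎
  where
  open ≡-Reasoning
  n = length L
  S = ∑[ z ∈ tuples s L ] ∑ z f
  collect : ∀ n p s σ → n * (p * σ + s * p * σ) ≡ (1 + s) * (n * p) * σ
  collect = solve-∀

∑-mono-All : {f g : A → ℕ} {xs : List A} → All (λ x → f x ≤ g x) xs → ∑ xs f ≤ ∑ xs g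
∑-mono-All []         = z≤n
∑-mono-All (f≤g ∷ hs) = +-mono-≤ f≤g (∑-mono-All hs)

∈⇒≤∑ : ∀ (f : A → ℕ) {x xs} → x ∈ xs → f x ≤ ∑ xs f
∈⇒≤∑ f (here refl) = m≤m+n _ _
∈⇒≤∑ f (there x∈)  = ≤-trans (∈⇒≤∑ f x∈) (m≤n+m _ _)

tuples-length : ∀ s (L : List A) → All (λ z → length z ≡ s) (tuples s L)
tuples-length zero    L = refl ∷ []
tuples-length (suc s) L = cartesianProductWith⁺ (setoid _) (setoid _) _∷_ L (tuples s L)
  (λ _ z∈ → cong suc (All.lookup (tuples-length s L) z∈))

-- One occurrence of the head is deleted from `ys`; uniqueness ensures that the remaining entries of
-- `xs` do not need it.
∑-unique-≤ : ∀ (f : A → ℕ) {xs ys} → Unique xs → (∀ {x} → x ∈ xs → x ∈ ys) → ∑ xs f ≤ ∑ ys f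
∑-unique-≤ f []                 xs⊆ys = z≤n
∑-unique-≤ f {x ∷ xs} (x∉xs ∷ uniq) xs⊆ys with as , bs , refl ← ∈-∃++ (xs⊆ys (here refl)) = begin
  f x + ∑ xs f             ≤⟨ +-monoʳ-≤ (f x) (∑-unique-≤ f uniq avoid) ⟩
  f x + ∑ (as ++ bs) f     ≡⟨ cong (f x +_) (∑-++ f as bs) ⟩
  f x + (∑ as f + ∑ bs f)  ≡⟨ swap (f x) (∑ as f) (∑ bs f) ⟩
  ∑ as f + (f x + ∑ bs f)  ≡⟨ ∑-++ f as (x ∷ bs) ⟨
  ∑ (as ++ x ∷ bs) f       ∎
  where
  open ≤-Reasoning
  swap : ∀ a b c → a + (b + c) ≡ b + (a + c)
  swap = solve-∀
  avoid : ∀ {y} → y ∈ xs → y ∈ as ++ bs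
  avoid y∈ with ∈-++⁻ as (xs⊆ys (there y∈))
  ... | inj₁ y∈as         = ∈-++⁺ˡ y∈as
  ... | inj₂ (here refl)  = contradiction refl (All.lookup x∉xs y∈)
  ... | inj₂ (there y∈bs) = ∈-++⁺ʳ as y∈bs

length-filter-≤-∑ : {A : Set} {P : A → Set} (P? : Decidable P) {f : A → ℕ} →
  (∀ {x} → P x → 1 ≤ f x) → ∀ xs → length (filter P? xs) ≤ ∑ xs f
length-filter-≤-∑ P? 1≤f []       = z≤n
length-filter-≤-∑ P? 1≤f (x ∷ xs) with P? x
... | yes px = +-mono-≤ (1≤f px) (length-filter-≤-∑ P? 1≤f xs)
... | no  _  = ≤-trans (length-filter-≤-∑ P? 1≤f xs) (m≤n+m _ _)

-- Weighted clique counts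

-- w is the 0/1 adjacency indicator.  A weight g marks the vertices allowed in a clique, and g ⊙ w x
-- restricts it to the neighbours of x, so T L s g counts the ordered s-cliques inside g.
module CliqueSums {A : Set} (w : A → A → ℕ)
                  (w-sym : ∀ x y → w x y ≡ w y x) (w≤1 : ∀ x y → w x y ≤ 1) where

  infixl 8 _⊙_
  _⊙_ : (A → ℕ) → (A → ℕ) → A → ℕ
  (g ⊙ h) x = g x * h x

  T : List A → ℕ → (A → ℕ) → ℕ
  T L zero    g = 1
  T L (suc s) g = ∑[ x ∈ L ] g x * T L s (g ⊙ w x)

  T-mono : ∀ L s {g h} → (∀ x → g x ≤ h x) → T L s g ≤ T L s h
  T-mono L zero    g≤h = ≤-refl
  T-mono L (suc s) g≤h =
    ∑-mono (λ x → *-mono-≤ (g≤h x) (T-mono L s (λ y → *-monoˡ-≤ (w x y) (g≤h y)))) L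

  T-cong : ∀ L s {g h} → (∀ x → g x ≡ h x) → T L s g ≡ T L s h
  T-cong L s g≡h = ≤-antisym (T-mono L s (λ x → ≤-reflexive (g≡h x)))
                             (T-mono L s (λ x → ≤-reflexive (sym (g≡h x))))

  -- The Moon-Moser inequalities

  -- V L s g is the sum over s-cliques of the squared number of common neighbours.
  V : List A → ℕ → (A → ℕ) → ℕ
  V L s g = ∑[ x ∈ L ] ∑[ v ∈ L ] g x * g v * T L s (g ⊙ w x ⊙ w v)

  ⊙-≤ : ∀ g x y → (g ⊙ w x) y ≤ g y
  ⊙-≤ g x y = ≤-trans (*-monoʳ-≤ (g y) (w≤1 x y)) (≤-reflexive (*-identityʳ (g y)))

  -- The first vertex y of the clique is summed outermost; symmetry of `w` turns its adjacency to x
  -- and v into a restriction of the weights at x and v.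
  V-suc : ∀ L s g → V L (suc s) g ≡ (∑[ y ∈ L ] g y * V L s (g ⊙ w y))
  V-suc L s g = begin
    (∑[ x ∈ L ] ∑[ v ∈ L ] g x * g v * (∑[ y ∈ L ] (g ⊙ w x ⊙ w v) y * T L s (g ⊙ w x ⊙ w v ⊙ w y)))
      ≡⟨ ∑-cong (λ x → ∑-cong (λ v → sym (∑-distribˡ (g x * g v) _ L)) L) L ⟩
    (∑[ x ∈ L ] ∑[ v ∈ L ] ∑[ y ∈ L ] F x v y)
      ≡⟨ ∑-cong (λ x → ∑-swap (F x) L L) L ⟩
    (∑[ x ∈ L ] ∑[ y ∈ L ] ∑[ v ∈ L ] F x v y)
      ≡⟨ ∑-swap _ L L ⟩
    (∑[ y ∈ L ] ∑[ x ∈ L ] ∑[ v ∈ L ] F x v y)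
      ≡⟨ ∑-cong (λ y → ∑-cong (λ x → ∑-cong (λ v → F≡F′ x v y) L) L) L ⟩
    (∑[ y ∈ L ] ∑[ x ∈ L ] ∑[ v ∈ L ] g y * F′ x v y)
      ≡⟨ ∑-cong (λ y → trans (∑-cong (λ x → ∑-distribˡ (g y) _ L) L) (∑-distribˡ (g y) _ L)) L ⟩
    (∑[ y ∈ L ] g y * V L s (g ⊙ w y)) ∎
    where
    open ≡-Reasoning
    F F′ : A → A → A → ℕ
    F x v y = g x * g v * ((g ⊙ w x ⊙ w v) y * T L s (g ⊙ w x ⊙ w v ⊙ w y))
    F′ x v y = (g ⊙ w y) x * (g ⊙ w y) v * T L s (g ⊙ w y ⊙ w x ⊙ w v)
    shuffle : ∀ a b c p q t → a * b * (c * p * q * t) ≡ c * (a * p * (b * q) * t)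
    shuffle = solve-∀
    shuffle′ : ∀ a p q r → a * p * q * r ≡ a * r * p * q
    shuffle′ = solve-∀
    F≡F′ : ∀ x v y → F x v y ≡ g y * F′ x v y
    F≡F′ x v y = begin
      F x v y
        ≡⟨ cong (λ t → g x * g v * ((g ⊙ w x ⊙ w v) y * t))
                (T-cong L s (λ z → shuffle′ (g z) (w x z) (w v z) (w y z))) ⟩
      g x * g v * (g y * w x y * w v y * T L s (g ⊙ w y ⊙ w x ⊙ w v))
        ≡⟨ cong₂ (λ p q → g x * g v * (g y * p * q * T L s (g ⊙ w y ⊙ w x ⊙ w v))) (w-sym x y) (w-sym v y) ⟩
      g x * g v * (g y * w y x * w y v * T L s (g ⊙ w y ⊙ w x ⊙ w v))
        ≡⟨ shuffle (g x) (g v) (g y) (w y x) (w y v) _ ⟩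
      g y * F′ x v y ∎

  0-1-exchange : ∀ {a b u} → a ≤ b → u ≤ 1 → a + u * b ≤ u * a + b
  0-1-exchange {u = zero}      a≤b u≤1 = ≤-trans (≤-reflexive (+-identityʳ _)) a≤b
  0-1-exchange {a} {b} {suc zero} a≤b u≤1 = ≤-reflexive (swap a b)
    where
    swap : ∀ a b → a + 1 * b ≡ 1 * a + b
    swap = solve-∀
  0-1-exchange {u = suc (suc u)} a≤b (s≤s ())

  -- Summand by summand this is (1 − w x v) (b − a) ≥ 0 with a = T L s (g ⊙ w x ⊙ w v) ≤ b = T L s (g ⊙ w x).
  exchange : ∀ L s g →
    V L s g + (∑[ x ∈ L ] g x * (∑ L (g ⊙ w x) * T L s (g ⊙ w x)))
      ≤ T L (suc (suc s)) g + ∑ L g * T L (suc s) g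
  exchange L s g = begin
    V L s g + (∑[ x ∈ L ] g x * (∑ L (g ⊙ w x) * b x))
      ≡⟨ cong (V L s g +_) (∑-cong (λ x → trans (shuffle₁ (g x) _ (b x)) (sym (∑-distribˡ (g x * b x) _ L))) L) ⟩
    V L s g + (∑[ x ∈ L ] ∑[ v ∈ L ] g x * b x * (g v * w x v))
      ≡⟨ ∑∑-distrib-+ _ _ L L ⟨
    (∑[ x ∈ L ] ∑[ v ∈ L ] g x * g v * a x v + g x * b x * (g v * w x v))
      ≤⟨ ∑∑-mono pointwise L L ⟩
    (∑[ x ∈ L ] ∑[ v ∈ L ] g x * (g v * w x v * a x v) + g x * b x * g v)
      ≡⟨ ∑∑-distrib-+ _ _ L L ⟩
    (∑[ x ∈ L ] ∑[ v ∈ L ] g x * (g v * w x v * a x v)) + (∑[ x ∈ L ] ∑[ v ∈ L ] g x * b x * g v)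
      ≡⟨ cong₂ _+_ (∑-cong (λ x → ∑-distribˡ (g x) _ L) L)
                   (trans (sym (∑-*-∑ _ g L L)) (*-comm (T L (suc s) g) (∑ L g))) ⟩
    T L (suc (suc s)) g + ∑ L g * T L (suc s) g ∎
    where
    open ≤-Reasoning
    b : A → ℕ
    b x = T L s (g ⊙ w x)
    a : A → A → ℕ
    a x v = T L s (g ⊙ w x ⊙ w v)
    shuffle₁ : ∀ p q r → p * (q * r) ≡ p * r * q
    shuffle₁ = solve-∀
    before : ∀ p q a b u → p * q * a + p * b * (q * u) ≡ p * q * (a + u * b)
    before = solve-∀
    after : ∀ p q a b u → p * q * (u * a + b) ≡ p * (q * u * a) + p * b * q
    after = solve-∀
    pointwise : ∀ x v → g x * g v * a x v + g x * b x * (g v * w x v)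
                      ≤ g x * (g v * w x v * a x v) + g x * b x * g v
    pointwise x v = begin
      _ ≡⟨ before (g x) (g v) (a x v) (b x) (w x v) ⟩
      g x * g v * (a x v + w x v * b x)
        ≤⟨ *-monoʳ-≤ (g x * g v) (0-1-exchange (T-mono L s (⊙-≤ (g ⊙ w x) v)) (w≤1 x v)) ⟩
      g x * g v * (w x v * a x v + b x) ≡⟨ after (g x) (g v) (a x v) (b x) (w x v) ⟩
      _ ∎

  -- For 0/1 weights, consider an (s+1)-clique and a vertex v. All s + 1 of its s-subsets are joined
  -- to v if v is joined to the whole clique, and otherwise at most one is; so their number is at
  -- most 1 plus s times the indicator of an (s+2)-clique. The induction spends s + 1 copies of `V`
  -- on the hypothesis inside each neighbourhood. The spare copy pays, through `exchange`, for
  -- replacing neighbourhood sizes by `∑ L g`.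
  V-bound : ∀ L s g → suc s * V L s g ≤ s * T L (suc (suc s)) g + ∑ L g * T L (suc s) g
  V-bound L zero    g = ≤-reflexive (begin
    V L 0 g + 0                                 ≡⟨ +-identityʳ _ ⟩
    (∑[ x ∈ L ] ∑[ v ∈ L ] g x * g v * 1)       ≡⟨ ∑-cong (λ x → ∑-cong (λ v → *-assoc (g x) (g v) 1) L) L ⟩
    (∑[ x ∈ L ] ∑[ v ∈ L ] g x * (g v * 1))     ≡⟨ ∑-*-∑ g _ L L ⟨
    ∑ L g * T L 1 g                             ∎)
    where open ≡-Reasoning
  V-bound L (suc s) g = begin
    V L (suc s) g + suc s * V L (suc s) g
      ≡⟨ cong (λ v → V L (suc s) g + suc s * v) (V-suc L s g) ⟩
    V L (suc s) g + suc s * (∑[ y ∈ L ] g y * V L s (g ⊙ w y))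
      ≡⟨ cong (V L (suc s) g +_) (trans (sym (∑-distribˡ (suc s) _ L))
                                        (∑-cong (λ y → shuffle (suc s) (g y) (V L s (g ⊙ w y))) L)) ⟩
    V L (suc s) g + (∑[ y ∈ L ] g y * (suc s * V L s (g ⊙ w y)))
      ≤⟨ +-monoʳ-≤ (V L (suc s) g) (∑-mono (λ y → *-monoʳ-≤ (g y) (V-bound L s (g ⊙ w y))) L) ⟩
    V L (suc s) g + (∑[ y ∈ L ] g y * (s * t₂ y + ∑ L (g ⊙ w y) * t₁ y))
      ≡⟨ cong (V L (suc s) g +_) (∑-cong (λ y → distrib (g y) s (t₂ y) (∑ L (g ⊙ w y) * t₁ y)) L) ⟩
    V L (suc s) g + (∑[ y ∈ L ] s * (g y * t₂ y) + g y * (∑ L (g ⊙ w y) * t₁ y))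
      ≡⟨ cong (V L (suc s) g +_) (trans (∑-distrib-+ _ _ L) (cong (_+ tail) (∑-distribˡ s _ L))) ⟩
    V L (suc s) g + (s * T L (3 + s) g + tail)
      ≡⟨ rotate (V L (suc s) g) (s * T L (3 + s) g) tail ⟩
    s * T L (3 + s) g + (V L (suc s) g + tail)
      ≤⟨ +-monoʳ-≤ (s * T L (3 + s) g) (exchange L (suc s) g) ⟩
    s * T L (3 + s) g + (T L (3 + s) g + ∑ L g * T L (2 + s) g)
      ≡⟨ regroup (s * T L (3 + s) g) (T L (3 + s) g) _ ⟩
    suc s * T L (3 + s) g + ∑ L g * T L (2 + s) g ∎
    where
    open ≤-Reasoning
    t₁ t₂ : A → ℕ
    t₁ y = T L (suc s) (g ⊙ w y)
    t₂ y = T L (suc (suc s)) (g ⊙ w y)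
    tail = ∑[ y ∈ L ] g y * (∑ L (g ⊙ w y) * t₁ y)
    shuffle : ∀ a b c → a * (b * c) ≡ b * (a * c)
    shuffle = solve-∀
    distrib : ∀ a s b c → a * (s * b + c) ≡ s * (a * b) + a * c
    distrib = solve-∀
    rotate : ∀ a b c → a + (b + c) ≡ b + (a + c)
    rotate = solve-∀
    regroup : ∀ a b c → a + (b + c) ≡ b + a + c
    regroup = solve-∀

  clique : (A → ℕ) → List A → ℕ
  clique g []      = 1
  clique g (x ∷ z) = g x * clique (g ⊙ w x) z

  T≡∑clique : ∀ L s g → T L s g ≡ ∑ (tuples s L) (clique g)
  T≡∑clique L zero    g = refl
  T≡∑clique L (suc s) g = sym (trans (∑-cartesianProductWith (clique g) _∷_ L (tuples s L))
    (∑-cong (λ x → trans (∑-distribˡ (g x) _ (tuples s L)) (cong (g x *_) (sym (T≡∑clique L s (g ⊙ w x))))) L))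

  clique-mono : ∀ z {g h} → (∀ x → g x ≤ h x) → clique g z ≤ clique h z
  clique-mono []      g≤h = ≤-refl
  clique-mono (x ∷ z) g≤h = *-mono-≤ (g≤h x) (clique-mono z (λ y → *-monoˡ-≤ (w x y) (g≤h y)))

  clique-cong : ∀ z {g h} → (∀ x → g x ≡ h x) → clique g z ≡ clique h z
  clique-cong z g≡h = ≤-antisym (clique-mono z (λ x → ≤-reflexive (g≡h x)))
                                (clique-mono z (λ x → ≤-reflexive (sym (g≡h x))))

  -- With h = `w x` this splits off the indicator that x is a common neighbour of z, leaving a
  -- factor that does not depend on x.
  clique-⊙ : ∀ z g h → clique (g ⊙ h) z ≡ clique g z * product (map h z)
  clique-⊙ []      g h = refl
  clique-⊙ (x ∷ z) g h = begin
    g x * h x * clique (g ⊙ h ⊙ w x) z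
      ≡⟨ cong (g x * h x *_) (clique-cong z (λ y → swap (g y) (h y) (w x y))) ⟩
    g x * h x * clique (g ⊙ w x ⊙ h) z
      ≡⟨ cong (g x * h x *_) (clique-⊙ z (g ⊙ w x) h) ⟩
    g x * h x * (clique (g ⊙ w x) z * product (map h z))
      ≡⟨ shuffle (g x) (h x) (clique (g ⊙ w x) z) _ ⟩
    g x * clique (g ⊙ w x) z * (h x * product (map h z)) ∎
    where
    open ≡-Reasoning
    swap : ∀ a b c → a * b * c ≡ a * c * b
    swap = solve-∀
    shuffle : ∀ a b c d → a * b * (c * d) ≡ a * c * (b * d)
    shuffle = solve-∀

  -- Cauchy-Schwarz over the s-tuples z with weights `clique g z`: `T` at s + 1 is the first moment
  -- of the number `deg z` of common neighbours, and `V` is its second moment.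
  cauchy : ∀ L s g → T L (suc s) g ^ 2 ≤ T L s g * V L s g
  cauchy L s g = begin
    T L (suc s) g ^ 2
      ≡⟨ cong (_^ 2) T-by-tuples ⟩
    (∑[ z ∈ Z ] clique g z * deg z) ^ 2
      ≤⟨ power-mean 1 (clique g) deg Z ⟩
    ∑ Z (clique g) ^ 1 * (∑[ z ∈ Z ] clique g z * deg z ^ 2)
      ≡⟨ cong₂ _*_ (trans (^-identityʳ _) (sym (T≡∑clique L s g))) (sym V-by-tuples) ⟩
    T L s g * V L s g ∎
    where
    Z = tuples s L
    p : A → List A → ℕ
    p x z = product (map (w x) z)
    deg : List A → ℕ
    deg z = ∑[ x ∈ L ] g x * p x z
    T-by-tuples : T L (suc s) g ≡ (∑[ z ∈ Z ] clique g z * deg z)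
    T-by-tuples = begin
      (∑[ x ∈ L ] g x * T L s (g ⊙ w x))
        ≡⟨ ∑-cong (λ x → cong (g x *_) (T≡∑clique L s (g ⊙ w x))) L ⟩
      (∑[ x ∈ L ] g x * (∑[ z ∈ Z ] clique (g ⊙ w x) z))
        ≡⟨ ∑-cong (λ x → sym (∑-distribˡ (g x) _ Z)) L ⟩
      (∑[ x ∈ L ] ∑[ z ∈ Z ] g x * clique (g ⊙ w x) z)
        ≡⟨ ∑-swap _ L Z ⟩
      (∑[ z ∈ Z ] ∑[ x ∈ L ] g x * clique (g ⊙ w x) z)
        ≡⟨ ∑-cong (λ z → trans (∑-cong (λ x → trans (cong (g x *_) (clique-⊙ z g (w x)))
                                                     (swap (g x) (clique g z) (p x z))) L)
                               (∑-distribˡ (clique g z) _ L)) Z ⟩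
      (∑[ z ∈ Z ] clique g z * deg z) ∎
      where
      open ≡-Reasoning
      swap : ∀ a b c → a * (b * c) ≡ b * (a * c)
      swap = solve-∀
    V-by-tuples : V L s g ≡ (∑[ z ∈ Z ] clique g z * deg z ^ 2)
    V-by-tuples = begin
      (∑[ x ∈ L ] ∑[ v ∈ L ] g x * g v * T L s (g ⊙ w x ⊙ w v))
        ≡⟨ ∑-cong (λ x → ∑-cong (λ v → trans (cong (g x * g v *_) (T≡∑clique L s (g ⊙ w x ⊙ w v)))
                                             (sym (∑-distribˡ (g x * g v) _ Z))) L) L ⟩
      (∑[ x ∈ L ] ∑[ v ∈ L ] ∑[ z ∈ Z ] g x * g v * clique (g ⊙ w x ⊙ w v) z)
        ≡⟨ trans (∑-cong (λ x → ∑-swap _ L Z) L) (∑-swap _ L Z) ⟩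
      (∑[ z ∈ Z ] ∑[ x ∈ L ] ∑[ v ∈ L ] g x * g v * clique (g ⊙ w x ⊙ w v) z)
        ≡⟨ ∑-cong (λ z → ∑-cong (λ x → ∑-cong (λ v → factor z x v) L) L) Z ⟩
      (∑[ z ∈ Z ] ∑[ x ∈ L ] ∑[ v ∈ L ] clique g z * (g x * p x z * (g v * p v z)))
        ≡⟨ ∑-cong (λ z → trans (∑-cong (λ x → ∑-distribˡ (clique g z) _ L) L) (∑-distribˡ (clique g z) _ L)) Z ⟩
      (∑[ z ∈ Z ] clique g z * (∑[ x ∈ L ] ∑[ v ∈ L ] g x * p x z * (g v * p v z)))
        ≡⟨ ∑-cong (λ z → cong (clique g z *_) (trans (sym (∑-*-∑ _ _ L L))
                                                      (cong (deg z *_) (sym (*-identityʳ (deg z)))))) Z ⟩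
      (∑[ z ∈ Z ] clique g z * deg z ^ 2) ∎
      where
      open ≡-Reasoning
      shuffle : ∀ a b c p q → a * b * (c * p * q) ≡ c * (a * p * (b * q))
      shuffle = solve-∀
      factor : ∀ z x v → g x * g v * clique (g ⊙ w x ⊙ w v) z ≡ clique g z * (g x * p x z * (g v * p v z))
      factor z x v = trans (cong (g x * g v *_) (trans (clique-⊙ z (g ⊙ w x) (w v))
                                                       (cong (_* p v z) (clique-⊙ z g (w x)))))
                           (shuffle (g x) (g v) (clique g z) (p x z) (p v z))
    open ≤-Reasoning

  moon-moser : ∀ L s g →
    suc s * T L (suc s) g ^ 2 ≤ T L s g * (s * T L (suc (suc s)) g + ∑ L g * T L (suc s) g)
  moon-moser L s g = begin
    suc s * T L (suc s) g ^ 2        ≤⟨ *-monoʳ-≤ (suc s) (cauchy L s g) ⟩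
    suc s * (T L s g * V L s g)      ≡⟨ swap (suc s) (T L s g) (V L s g) ⟩
    T L s g * (suc s * V L s g)      ≤⟨ *-monoʳ-≤ (T L s g) (V-bound L s g) ⟩
    T L s g * (s * T L (suc (suc s)) g + ∑ L g * T L (suc s) g) ∎
    where
    open ≤-Reasoning
    swap : ∀ a b c → a * (b * c) ≡ b * (a * c)
    swap = solve-∀

  -- From unordered to ordered cliques

  clique≤1 : ∀ z {g} → (∀ x → g x ≤ 1) → clique g z ≤ 1
  clique≤1 []      g≤1 = ≤-refl
  clique≤1 (x ∷ z) g≤1 = *-mono-≤ (g≤1 x) (clique≤1 z (λ y → *-mono-≤ (g≤1 y) (w≤1 x y)))

  1≤clique : ∀ {R : A → A → Set} → (∀ {x y} → R x y → 1 ≤ w x y) →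
    ∀ {z g} → All (λ x → 1 ≤ g x) z → AllPairs R z → 1 ≤ clique g z
  1≤clique R⇒w []          []         = ≤-refl
  1≤clique R⇒w (1≤g ∷ gs) (rs ∷ rss) =
    *-mono-≤ 1≤g (1≤clique R⇒w (All.zipWith (λ (1≤g , r) → *-mono-≤ 1≤g (R⇒w r)) (gs , rs)) rss)

  -- A clique that uses the new entry x once has s + 1 positions for it. Equality can fail because x
  -- may be adjacent to itself, as the empty set is disjoint from itself, and then tuples repeating
  -- x count too.
  T-∷ : ∀ s x L g → T L (suc s) g + suc s * (g x * T L s (g ⊙ w x)) ≤ T (x ∷ L) (suc s) g
  T-∷ zero    x L g = ≤-reflexive (trans (cong (T L 1 g +_) (*-identityˡ _)) (+-comm (T L 1 g) _))
  T-∷ (suc r) x L g = begin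
    T L (2 + r) g + suc (suc r) * (g x * T L (suc r) (g ⊙ w x))
      ≡⟨ regroup (T L (2 + r) g) (suc r) (g x * T L (suc r) (g ⊙ w x)) ⟩
    g x * T L (suc r) (g ⊙ w x) + (T L (2 + r) g + suc r * (g x * T L (suc r) (g ⊙ w x)))
      ≡⟨ cong (λ u → g x * T L (suc r) (g ⊙ w x) + (T L (2 + r) g + u)) through-x ⟩
    g x * T L (suc r) (g ⊙ w x) + (T L (2 + r) g + (∑[ y ∈ L ] g y * t y))
      ≡⟨ cong (g x * T L (suc r) (g ⊙ w x) +_) (∑-distrib-+ _ _ L) ⟨
    g x * T L (suc r) (g ⊙ w x) + (∑[ y ∈ L ] g y * T L (suc r) (g ⊙ w y) + g y * t y)
      ≤⟨ +-mono-≤ (*-monoʳ-≤ (g x) (≤-trans (m≤m+n _ _) (T-∷ r x L (g ⊙ w x))))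
                  (∑-mono (λ y → ≤-trans (≤-reflexive (sym (*-distribˡ-+ (g y) _ (t y))))
                                         (*-monoʳ-≤ (g y) (T-∷ r x L (g ⊙ w y)))) L) ⟩
    T (x ∷ L) (2 + r) g ∎
    where
    open ≤-Reasoning
    t : A → ℕ
    t y = suc r * ((g ⊙ w y) x * T L r (g ⊙ w y ⊙ w x))
    regroup : ∀ a r b → a + (1 + r) * b ≡ b + (a + r * b)
    regroup = solve-∀
    swap : ∀ a b c → a * b * c ≡ a * c * b
    swap = solve-∀
    shuffle : ∀ r a b c d → r * (a * (b * c * d)) ≡ b * (r * (a * c * d))
    shuffle = solve-∀
    through : ∀ y → suc r * (g x * ((g ⊙ w x) y * T L r (g ⊙ w x ⊙ w y))) ≡ g y * t y
    through y = trans
      (cong₂ (λ p q → suc r * (g x * (g y * p * q))) (w-sym x y) (T-cong L r (λ z → swap (g z) (w x z) (w y z))))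
      (shuffle (suc r) (g x) (g y) (w y x) (T L r (g ⊙ w y ⊙ w x)))
    through-x : suc r * (g x * T L (suc r) (g ⊙ w x)) ≡ (∑[ y ∈ L ] g y * t y)
    through-x = trans (cong (suc r *_) (sym (∑-distribˡ (g x) _ L)))
                      (trans (sym (∑-distribˡ (suc r) _ L)) (∑-cong through L))

  combinations-≤-T : ∀ k L g → ∑ (combinations k L) (clique g) * k ! ≤ T L k g
  combinations-≤-T zero    L       g = ≤-refl
  combinations-≤-T (suc k) []      g = z≤n
  combinations-≤-T (suc k) (x ∷ L) g = begin
    ∑ (map (x ∷_) Cₖ ++ combinations (suc k) L) (clique g) * suc k !
      ≡⟨ cong (_* suc k !) (trans (∑-++ (clique g) (map (x ∷_) Cₖ) _)
           (cong (_+ S) (trans (∑-map (clique g) (x ∷_) Cₖ) (∑-distribˡ (g x) _ Cₖ)))) ⟩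
    (g x * ∑ Cₖ (clique (g ⊙ w x)) + S) * suc k !
      ≡⟨ regroup (g x) (∑ Cₖ (clique (g ⊙ w x))) S k (k !) ⟩
    S * suc k ! + suc k * (g x * (∑ Cₖ (clique (g ⊙ w x)) * k !))
      ≤⟨ +-mono-≤ (combinations-≤-T (suc k) L g)
                  (*-monoʳ-≤ (suc k) (*-monoʳ-≤ (g x) (combinations-≤-T k L (g ⊙ w x)))) ⟩
    T L (suc k) g + suc k * (g x * T L k (g ⊙ w x))
      ≤⟨ T-∷ k x L g ⟩
    T (x ∷ L) (suc k) g ∎
    where
    open ≤-Reasoning
    Cₖ = combinations k L
    S = ∑ (combinations (suc k) L) (clique g)
    regroup : ∀ a b s k f → (a * b + s) * ((1 + k) * f) ≡ s * ((1 + k) * f) + (1 + k) * (a * (b * f))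
    regroup = solve-∀

  -- Blow-up of cliques to unions

  module Unions (_∪_ : A → A → A) (w-∪ : ∀ x y z → w (x ∪ y) z ≡ w x z * w y z) where

    -- For a 0/1 weight this says that the allowed vertices are closed under `_∪_`.
    SuperMult : (A → ℕ) → Set
    SuperMult g = ∀ x y → g x * g y ≤ g (x ∪ y)

    unions-super : ∀ {g} → SuperMult g → ∀ t L → ∑ L g ^ suc t ≤ ∑ (products _∪_ t L) g
    unions-super {g} super zero    L = ≤-reflexive (*-identityʳ _)
    unions-super {g} super (suc t) L = begin
      ∑ L g * ∑ L g ^ suc t                                ≤⟨ *-monoʳ-≤ (∑ L g) (unions-super super t L) ⟩
      ∑ L g * ∑ (products _∪_ t L) g                       ≡⟨ ∑-*-∑ g g L P ⟩
      (∑[ x ∈ L ] ∑[ y ∈ products _∪_ t L ] g x * g y)     ≤⟨ ∑∑-mono super L P ⟩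
      (∑[ x ∈ L ] ∑[ y ∈ products _∪_ t L ] g (x ∪ y))     ≡⟨ ∑-cartesianProductWith g _∪_ L P ⟨
      ∑ (products _∪_ (suc t) L) g                         ∎
      where
      open ≤-Reasoning
      P = products _∪_ t L

    unions-w : ∀ z t L → (∑[ u ∈ products _∪_ t L ] w u z) ≡ (∑[ x ∈ L ] w x z) ^ suc t
    unions-w z zero    L = sym (*-identityʳ _)
    unions-w z (suc t) L = begin
      (∑[ u ∈ products _∪_ (suc t) L ] w u z)                      ≡⟨ ∑-cartesianProductWith _ _∪_ L P ⟩
      (∑[ x ∈ L ] ∑[ y ∈ products _∪_ t L ] w (x ∪ y) z)           ≡⟨ ∑-cong (λ x → ∑-cong (λ y → w-∪ x y z) P) L ⟩
      (∑[ x ∈ L ] ∑[ y ∈ products _∪_ t L ] w x z * w y z)         ≡⟨ ∑-*-∑ _ _ L P ⟨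
      (∑[ x ∈ L ] w x z) * (∑[ y ∈ products _∪_ t L ] w y z)       ≡⟨ cong ((∑[ x ∈ L ] w x z) *_) (unions-w z t L) ⟩
      (∑[ x ∈ L ] w x z) ^ suc (suc t)                             ∎
      where
      open ≡-Reasoning
      P = products _∪_ t L

    clique-super : ∀ z {g h k} → (∀ x → g x * h x ≤ k x) → clique g z * clique h z ≤ clique k z
    clique-super []      gh≤k = ≤-refl
    clique-super (x ∷ z) {g} {h} {k} gh≤k = begin
      g x * clique (g ⊙ w x) z * (h x * clique (h ⊙ w x) z)     ≡⟨ [m*n]*[o*p]≡[m*o]*[n*p] (g x) _ (h x) _ ⟩
      g x * h x * (clique (g ⊙ w x) z * clique (h ⊙ w x) z)     ≤⟨ *-mono-≤ (gh≤k x) (clique-super z restricted) ⟩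
      k x * clique (k ⊙ w x) z                                  ∎
      where
      open ≤-Reasoning
      restricted : ∀ y → g y * w x y * (h y * w x y) ≤ k y * w x y
      restricted y = begin
        g y * w x y * (h y * w x y)   ≡⟨ [m*n]*[o*p]≡[m*o]*[n*p] (g y) (w x y) (h y) (w x y) ⟩
        g y * h y * (w x y * w x y)   ≤⟨ *-mono-≤ (gh≤k y) (≤-trans (*-monoˡ-≤ (w x y) (w≤1 x y)) (≤-reflexive (*-identityˡ _))) ⟩
        k y * w x y                   ∎

    w-super : ∀ z → SuperMult (w z)
    w-super z x y = ≤-reflexive (begin
      w z x * w z y   ≡⟨ cong₂ _*_ (w-sym z x) (w-sym z y) ⟩
      w x z * w y z   ≡⟨ w-∪ x y z ⟨
      w (x ∪ y) z     ≡⟨ w-sym (x ∪ y) z ⟩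
      w z (x ∪ y)     ∎)
      where open ≡-Reasoning

    ⊙-super : ∀ {g h} → SuperMult g → SuperMult h → SuperMult (g ⊙ h)
    ⊙-super {g} {h} g-super h-super x y = begin
      g x * h x * (g y * h y)     ≡⟨ [m*n]*[o*p]≡[m*o]*[n*p] (g x) (h x) (g y) (h y) ⟩
      g x * g y * (h x * h y)     ≤⟨ *-mono-≤ (g-super x y) (h-super x y) ⟩
      g (x ∪ y) * h (x ∪ y)       ∎
      where open ≤-Reasoning

    -- With the tail z fixed, the heads completing z to a clique are closed under `_∪_`. This is
    -- what lets one coordinate be replaced by unions while the others stay put.
    head-super : ∀ {g} → SuperMult g → (∀ x → g x ≤ 1) → ∀ z → SuperMult (λ x → clique g (x ∷ z))
    head-super {g} super g≤1 z x y = begin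
      g x * clique (g ⊙ w x) z * (g y * clique (g ⊙ w y) z)     ≡⟨ [m*n]*[o*p]≡[m*o]*[n*p] (g x) _ (g y) _ ⟩
      g x * g y * (clique (g ⊙ w x) z * clique (g ⊙ w y) z)     ≤⟨ *-mono-≤ (super x y) (clique-super z pointwise) ⟩
      g (x ∪ y) * clique (g ⊙ w (x ∪ y)) z                      ∎
      where
      open ≤-Reasoning
      pointwise : ∀ v → g v * w x v * (g v * w y v) ≤ g v * w (x ∪ y) v
      pointwise v = begin
        g v * w x v * (g v * w y v)   ≡⟨ [m*n]*[o*p]≡[m*o]*[n*p] (g v) (w x v) (g v) (w y v) ⟩
        g v * g v * (w x v * w y v)   ≤⟨ *-mono-≤ (≤-trans (*-monoˡ-≤ (g v) (g≤1 v)) (≤-reflexive (*-identityˡ _)))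
                                                  (≤-reflexive (sym (w-∪ x y v))) ⟩
        g v * w (x ∪ y) v             ∎

    -- In densities, with N′ = |L|^(t+1): (T L s / |L|^s)^((t+1)^s) ≤ T L′ s / N′^s, by one power mean
    -- inequality over the choices of the remaining coordinates for each coordinate.
    blow-up : ∀ t s L .{{_ : NonZero (length L)}} {g} → SuperMult g → (∀ x → g x ≤ 1) →
      T L s g ^ (suc t ^ s) * (length L ^ suc t) ^ s
        ≤ (length L ^ s) ^ (suc t ^ s) * T (products _∪_ t L) s g
    blow-up t zero    L super g≤1 = ≤-refl
    blow-up t (suc s) L {g} super g≤1 = *-cancelˡ-≤ (Z ^ τ) (begin
      Z ^ τ * (a ^ (τ * e) * (N ^ τ) ^ suc s)
        ≡⟨ cong (λ p → Z ^ τ * (p * (N ^ τ * Z))) (exponent a) ⟩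
      Z ^ τ * ((a ^ e) ^ τ * (N ^ τ * Z))
        ≡⟨ shuffle₁ (Z ^ τ) ((a ^ e) ^ τ) (N ^ τ) Z ⟩
      (a ^ e) ^ τ * (N ^ τ * Z ^ τ) * Z
        ≡⟨ cong (_* Z) (trans (cong ((a ^ e) ^ τ *_) (sym (^-distribʳ-* τ N Z))) (sym (^-distribʳ-* τ (a ^ e) (N * Z)))) ⟩
      (a ^ e * (N * Z)) ^ τ * Z
        ≤⟨ *-monoˡ-≤ Z (^-monoˡ-≤ τ outer) ⟩
      (κ * Y) ^ τ * Z
        ≡⟨ trans (cong (_* Z) (^-distribʳ-* τ κ Y)) (*-assoc (κ ^ τ) (Y ^ τ) Z) ⟩
      κ ^ τ * (Y ^ τ * Z)
        ≤⟨ *-monoʳ-≤ (κ ^ τ) inner ⟩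
      κ ^ τ * (Z ^ τ * T P (suc s) g)
        ≡⟨ trans (shuffle₂ (κ ^ τ) (Z ^ τ) (T P (suc s) g)) (cong (λ p → Z ^ τ * (p * T P (suc s) g)) (sym (exponent (N * N ^ s)))) ⟩
      Z ^ τ * ((N ^ suc s) ^ (τ * e) * T P (suc s) g) ∎)
      where
      open ≤-Reasoning
      τ = suc t
      e = τ ^ s
      P = products _∪_ t L
      N = length L
      Z = (N ^ τ) ^ s
      a = T L (suc s) g
      κ = (N * N ^ s) ^ e
      b : A → ℕ
      b x = T L s (g ⊙ w x)
      Y = ∑[ x ∈ L ] g x * T P s (g ⊙ w x)
      instance
        Z≢0 : NonZero (Z ^ τ)
        Z≢0 = m^n≢0 Z τ {{m^n≢0 (N ^ τ) s {{m^n≢0 N τ}}}}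
      exponent : ∀ x → x ^ (τ * e) ≡ (x ^ e) ^ τ
      exponent x = trans (cong (x ^_) (*-comm τ e)) (sym (^-*-assoc x e τ))
      shuffle₁ : ∀ p q r s → p * (q * (r * s)) ≡ q * (r * p) * s
      shuffle₁ = solve-∀
      shuffle₂ : ∀ p q r → p * (q * r) ≡ q * (p * r)
      shuffle₂ = solve-∀
      -- The weight is 0 or 1, so the power mean exponent may be dropped from it.
      g^e≤g : ∀ x → g x ^ e ≤ g x
      g^e≤g x = 0-1-power e (m^n≢0 τ s) (g≤1 x)
      summand : ∀ x → (g x * b x) ^ e * Z ≤ g x * ((N ^ s) ^ e * T P s (g ⊙ w x))
      summand x = begin
        (g x * b x) ^ e * Z          ≡⟨ trans (cong (_* Z) (^-distribʳ-* e (g x) (b x))) (*-assoc (g x ^ e) _ Z) ⟩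
        g x ^ e * (b x ^ e * Z)      ≤⟨ *-mono-≤ (g^e≤g x) (blow-up t s L (⊙-super {g} {w x} super (w-super x)) (λ y → ≤-trans (⊙-≤ g x y) (g≤1 y))) ⟩
        g x * ((N ^ s) ^ e * T P s (g ⊙ w x)) ∎
      -- Averaging over the head x with exponent e makes room for the induction hypothesis, which
      -- turns the s tail coordinates into unions. `Y` counts the resulting mixed cliques: head in
      -- `L`, tail in `P`.
      outer : a ^ e * (N * Z) ≤ κ * Y
      outer = begin
        a ^ e * (N * Z)
          ≡⟨ *-assoc (a ^ e) N Z ⟨
        a ^ e * N * Z
          ≤⟨ *-monoˡ-≤ Z (power-mean-uniform e (m^n≢0 τ s) (λ x → g x * b x) L) ⟩
        N ^ e * (∑[ x ∈ L ] (g x * b x) ^ e) * Z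
          ≡⟨ trans (*-assoc (N ^ e) _ Z) (cong (N ^ e *_) (sym (∑-distribʳ Z _ L))) ⟩
        N ^ e * (∑[ x ∈ L ] (g x * b x) ^ e * Z)
          ≤⟨ *-monoʳ-≤ (N ^ e) (∑-mono summand L) ⟩
        N ^ e * (∑[ x ∈ L ] g x * ((N ^ s) ^ e * T P s (g ⊙ w x)))
          ≡⟨ cong (N ^ e *_) (trans (∑-cong (λ x → shuffle₂ (g x) ((N ^ s) ^ e) _) L) (∑-distribˡ ((N ^ s) ^ e) _ L)) ⟩
        N ^ e * ((N ^ s) ^ e * Y)
          ≡⟨ trans (sym (*-assoc (N ^ e) _ Y)) (cong (_* Y) (sym (^-distribʳ-* e N (N ^ s)))) ⟩
        κ * Y ∎
      R = tuples s P
      d : List A → ℕ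
      d z = ∑[ x ∈ L ] clique g (x ∷ z)
      Y≡∑d : Y ≡ ∑ R d
      Y≡∑d = trans (∑-cong (λ x → trans (cong (g x *_) (T≡∑clique P s (g ⊙ w x))) (sym (∑-distribˡ (g x) _ R))) L)
                   (∑-swap _ L R)
      length-R : length R ≡ Z
      length-R = trans (length-tuples s P) (cong (_^ s) (length-products _∪_ t L))
      -- Averaging over the tails with exponent τ gives τ heads for a common tail, and these merge
      -- into one union.
      inner : Y ^ τ * Z ≤ Z ^ τ * T P (suc s) g
      inner = begin
        Y ^ τ * Z                        ≡⟨ cong₂ (λ y z → y ^ τ * z) Y≡∑d (sym length-R) ⟩
        ∑ R d ^ τ * length R             ≤⟨ power-mean-uniform τ _ d R ⟩
        length R ^ τ * (∑[ z ∈ R ] d z ^ τ)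
          ≤⟨ *-monoʳ-≤ (length R ^ τ) (∑-mono (λ z → unions-super (head-super super g≤1 z) t L) R) ⟩
        length R ^ τ * (∑[ z ∈ R ] ∑[ u ∈ P ] clique g (u ∷ z))
          ≡⟨ cong₂ _*_ (cong (_^ τ) length-R) (trans (∑-swap _ R P) (sym (∑-cartesianProductWith (clique g) _∷_ P R))) ⟩
        Z ^ τ * ∑ (tuples (suc s) P) (clique g)
          ≡⟨ cong (Z ^ τ *_) (T≡∑clique P (suc s) g) ⟨
        Z ^ τ * T P (suc s) g ∎

-- Binomial coefficients, Bernoulli's inequality and powers

absorption : ∀ n k → suc k * (suc n C suc k) ≡ suc n * (n C k)
absorption zero    zero    = refl
absorption zero    (suc k) = *-zeroʳ (2 + k)
absorption (suc n) zero    = trans (*-identityˡ _) (trans (nC1≡n (2 + n)) (sym (*-identityʳ (2 + n))))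
absorption (suc n) (suc k) = begin
  (2 + k) * ((2 + n) C (2 + k))
    ≡⟨ cong ((2 + k) *_) (nCk+nC[k+1]≡[n+1]C[k+1] (suc n) (suc k)) ⟨
  (2 + k) * (suc n C suc k + suc n C (2 + k))
    ≡⟨ distrib k (suc n C suc k) _ ⟩
  suc n C suc k + (suc k * (suc n C suc k) + (2 + k) * (suc n C (2 + k)))
    ≡⟨ cong (suc n C suc k +_) (cong₂ _+_ (absorption n k) (absorption n (suc k))) ⟩
  suc n C suc k + (suc n * (n C k) + suc n * (n C suc k))
    ≡⟨ cong (suc n C suc k +_) (trans (sym (*-distribˡ-+ (suc n) (n C k) _)) (cong (suc n *_) (nCk+nC[k+1]≡[n+1]C[k+1] n k))) ⟩
  (2 + n) * (suc n C suc k) ∎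
  where
  open ≡-Reasoning
  distrib : ∀ k a b → (2 + k) * (a + b) ≡ a + ((1 + k) * a + (2 + k) * b)
  distrib = solve-∀

[n∸k]^k≤nCk*k! : ∀ n k → (n ∸ k) ^ k ≤ (n C k) * k !
[n∸k]^k≤nCk*k! n       zero    = ≤-refl
[n∸k]^k≤nCk*k! zero    (suc k) = z≤n
[n∸k]^k≤nCk*k! (suc n) (suc k) = begin
  (n ∸ k) * (n ∸ k) ^ k               ≤⟨ *-mono-≤ (≤-trans (m∸n≤m n k) (n≤1+n n)) ([n∸k]^k≤nCk*k! n k) ⟩
  suc n * ((n C k) * k !)             ≡⟨ *-assoc (suc n) (n C k) (k !) ⟨
  suc n * (n C k) * k !               ≡⟨ cong (_* k !) (absorption n k) ⟨
  suc k * (suc n C suc k) * k !       ≡⟨ swap (suc k) (suc n C suc k) (k !) ⟩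
  (suc n C suc k) * suc k !           ∎
  where
  open ≤-Reasoning
  swap : ∀ a b c → a * b * c ≡ b * (a * c)
  swap = solve-∀

-- Bernoulli's inequality (1 - x)^k ≥ 1 - kx at x = a/(l + a), multiplied by (l + a)^(k+1).
bernoulli : ∀ a l k → (l + a) ^ k * (l + a) ≤ l ^ k * (l + a) + k * a * (l + a) ^ k
bernoulli a l zero    = m≤m+n _ 0
bernoulli a l (suc k) = begin
  (l + a) * (l + a) ^ k * (l + a)                                  ≡⟨ *-assoc (l + a) _ _ ⟩
  (l + a) * ((l + a) ^ k * (l + a))                                ≤⟨ *-monoʳ-≤ (l + a) (bernoulli a l k) ⟩
  (l + a) * (l ^ k * (l + a) + k * a * (l + a) ^ k)                ≡⟨ expand l a k (l ^ k) ((l + a) ^ k) ⟩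
  l * l ^ k * (l + a) + k * a * ((l + a) * (l + a) ^ k) + a * ((l + a) * l ^ k)
    ≤⟨ +-monoʳ-≤ (l ^ suc k * (l + a) + k * a * (l + a) ^ suc k) (*-monoʳ-≤ a (*-monoʳ-≤ (l + a) (^-monoˡ-≤ k (m≤m+n l a)))) ⟩
  l * l ^ k * (l + a) + k * a * ((l + a) * (l + a) ^ k) + a * ((l + a) * (l + a) ^ k)
    ≡⟨ collect (l * l ^ k * (l + a)) k a ((l + a) * (l + a) ^ k) ⟩
  l ^ suc k * (l + a) + suc k * a * (l + a) ^ suc k                ∎
  where
  open ≤-Reasoning
  expand : ∀ l a k p q → (l + a) * (p * (l + a) + k * a * q) ≡ l * p * (l + a) + k * a * ((l + a) * q) + a * ((l + a) * p)
  expand = solve-∀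
  collect : ∀ x k a q → x + k * a * q + a * q ≡ x + (1 + k) * a * q
  collect = solve-∀

-- (l/(l + a))^k ≥ 1 − k a/(l + a) ≥ Q/(Q + 1).
power-ratio : ∀ a l k Q .{{_ : NonZero (l + a)}} → k * a * suc Q ≤ l + a → (l + a) ^ k * Q ≤ l ^ k * suc Q
power-ratio a l k Q large = *-cancelˡ-≤ (l + a) (+-cancelʳ-≤ (k * a * p * suc Q) _ _ (begin
  (l + a) * (p * Q) + k * a * p * suc Q   ≡⟨ cong ((l + a) * (p * Q) +_) (swap k a p (suc Q)) ⟩
  (l + a) * (p * Q) + p * (k * a * suc Q) ≤⟨ +-monoʳ-≤ ((l + a) * (p * Q)) (*-monoʳ-≤ p large) ⟩
  (l + a) * (p * Q) + p * (l + a)         ≡⟨ collect (l + a) p Q ⟩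
  p * (l + a) * suc Q                     ≤⟨ *-monoˡ-≤ (suc Q) (bernoulli a l k) ⟩
  (l ^ k * (l + a) + k * a * p) * suc Q   ≡⟨ distrib (l ^ k) (l + a) (k * a * p) (suc Q) ⟩
  (l + a) * (l ^ k * suc Q) + k * a * p * suc Q ∎))
  where
  open ≤-Reasoning
  p = (l + a) ^ k
  swap : ∀ k a p r → k * a * p * r ≡ p * (k * a * r)
  swap = solve-∀
  collect : ∀ e p q → e * (p * q) + p * e ≡ p * e * (1 + q)
  collect = solve-∀
  distrib : ∀ x e y r → (x * e + y) * r ≡ e * (x * r) + y * r
  distrib = solve-∀

^-cancelˡ-≤ : ∀ {x y} e .{{_ : NonZero e}} → x ^ e ≤ y ^ e → x ≤ y
^-cancelˡ-≤ e h = ≮⇒≥ (λ y<x → <⇒≱ (^-monoˡ-< e y<x) h)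

^-swap : ∀ x a b → (x ^ a) ^ b ≡ (x ^ b) ^ a
^-swap x a b = trans (^-*-assoc x a b) (trans (cong (x ^_) (*-comm a b)) (sym (^-*-assoc x b a)))

1≤m*n⇒1≤m×1≤n : ∀ {a b} → 1 ≤ a * b → 1 ≤ a × 1 ≤ b
1≤m*n⇒1≤m×1≤n {suc a} {suc b} _ = s≤s z≤n , s≤s z≤n
1≤m*n⇒1≤m×1≤n {suc a} {zero}  h with () ← subst (1 ≤_) (*-zeroʳ a) h

-- Disjointness of finite sets as a 0/1 weight

private variable
  n : ℕ

-- The bitwise recursion makes multiplicativity under `_∪_` a matter of cases on the bits.
disj : Subset n → Subset n → ℕ
disj []            []            = 1
disj (inside ∷ p)  (inside ∷ q)  = 0
disj (inside ∷ p)  (outside ∷ q) = disj p q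
disj (outside ∷ p) (inside ∷ q)  = disj p q
disj (outside ∷ p) (outside ∷ q) = disj p q

disj-sym : ∀ (p q : Subset n) → disj p q ≡ disj q p
disj-sym []            []            = refl
disj-sym (inside ∷ p)  (inside ∷ q)  = refl
disj-sym (inside ∷ p)  (outside ∷ q) = disj-sym p q
disj-sym (outside ∷ p) (inside ∷ q)  = disj-sym p q
disj-sym (outside ∷ p) (outside ∷ q) = disj-sym p q

disj≤1 : ∀ (p q : Subset n) → disj p q ≤ 1
disj≤1 []            []            = ≤-refl
disj≤1 (inside ∷ p)  (inside ∷ q)  = z≤n
disj≤1 (inside ∷ p)  (outside ∷ q) = disj≤1 p q
disj≤1 (outside ∷ p) (inside ∷ q)  = disj≤1 p q
disj≤1 (outside ∷ p) (outside ∷ q) = disj≤1 p q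

disj-∪ : ∀ (p q r : Subset n) → disj (p ∪ q) r ≡ disj p r * disj q r
disj-∪ []            []            []            = refl
disj-∪ (inside ∷ p)  (x ∷ q)       (inside ∷ r)  = refl
disj-∪ (outside ∷ p) (inside ∷ q)  (inside ∷ r)  = sym (*-zeroʳ (disj p r))
disj-∪ (outside ∷ p) (outside ∷ q) (inside ∷ r)  = disj-∪ p q r
disj-∪ (inside ∷ p)  (inside ∷ q)  (outside ∷ r) = disj-∪ p q r
disj-∪ (inside ∷ p)  (outside ∷ q) (outside ∷ r) = disj-∪ p q r
disj-∪ (outside ∷ p) (inside ∷ q)  (outside ∷ r) = disj-∪ p q r
disj-∪ (outside ∷ p) (outside ∷ q) (outside ∷ r) = disj-∪ p q r

Disjoint⇒1≤disj : ∀ {p q : Subset n} → Disjoint p q → 1 ≤ disj p q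
Disjoint⇒1≤disj {p = []}          {[]}          d = ≤-refl
Disjoint⇒1≤disj {p = inside ∷ p}  {inside ∷ q}  d = contradiction (zero , here) d
Disjoint⇒1≤disj {p = inside ∷ p}  {outside ∷ q} d = Disjoint⇒1≤disj {p = p} (λ (i , h) → d (suc i , there h))
Disjoint⇒1≤disj {p = outside ∷ p} {inside ∷ q}  d = Disjoint⇒1≤disj {p = p} (λ (i , h) → d (suc i , there h))
Disjoint⇒1≤disj {p = outside ∷ p} {outside ∷ q} d = Disjoint⇒1≤disj {p = p} (λ (i , h) → d (suc i , there h))

disj-∁ : ∀ (p : Subset n) → disj p (∁ p) ≡ 1
disj-∁ []            = refl
disj-∁ (inside ∷ p)  = disj-∁ p
disj-∁ (outside ∷ p) = disj-∁ p

∁-involutive : ∀ (p : Subset n) → ∁ (∁ p) ≡ p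
∁-involutive []      = refl
∁-involutive (x ∷ p) = cong₂ _∷_ (not-involutive x) (∁-involutive p)

1≤disj⇒∣∪∣ : ∀ (p q : Subset n) → 1 ≤ disj p q → ∣ p ∣ + ∣ q ∣ ≡ ∣ p ∪ q ∣
1≤disj⇒∣∪∣ []            []            h = refl
1≤disj⇒∣∪∣ (inside ∷ p)  (outside ∷ q) h = cong suc (1≤disj⇒∣∪∣ p q h)
1≤disj⇒∣∪∣ (outside ∷ p) (inside ∷ q)  h = trans (+-suc ∣ p ∣ ∣ q ∣) (cong suc (1≤disj⇒∣∪∣ p q h))
1≤disj⇒∣∪∣ (outside ∷ p) (outside ∷ q) h = 1≤disj⇒∣∪∣ p q h

subsets : ∀ n → List (Subset n)
subsets zero    = [] ∷ []
subsets (suc n) = cartesianProductWith _∷_ (outside ∷ inside ∷ []) (subsets n)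

∈-subsets : ∀ (p : Subset n) → p ∈ subsets n
∈-subsets []            = here refl
∈-subsets (outside ∷ p) = ∈-cartesianProductWith⁺ _∷_ {xs = outside ∷ inside ∷ []} (here refl) (∈-subsets p)
∈-subsets (inside ∷ p)  = ∈-cartesianProductWith⁺ _∷_ {xs = outside ∷ inside ∷ []} (there (here refl)) (∈-subsets p)

length-subsets : ∀ n → length (subsets n) ≡ 2 ^ n
length-subsets zero    = refl
length-subsets (suc n) = trans (length-cartesianProductWith _∷_ (outside ∷ inside ∷ []) (subsets n)) (cong (2 *_) (length-subsets n))

-- The sets disjoint from q are the subsets of its complement.
∑-disj : ∀ (q : Subset n) → (∑[ p ∈ subsets n ] disj p q) ≡ 2 ^ ∣ ∁ q ∣
∑-disj []                    = refl
∑-disj {n = suc n} (inside ∷ q)  = begin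
  (∑[ p ∈ subsets (suc n) ] disj p (inside ∷ q))
    ≡⟨ ∑-cartesianProductWith (λ p → disj p (inside ∷ q)) _∷_ (outside ∷ inside ∷ []) (subsets n) ⟩
  (∑[ p ∈ subsets n ] disj p q) + ((∑[ p ∈ subsets n ] 0) + 0)
    ≡⟨ cong₂ (λ a b → a + (b + 0)) (∑-disj q) (trans (∑-const 0 (subsets n)) (*-zeroʳ (length (subsets n)))) ⟩
  2 ^ ∣ ∁ q ∣ + 0
    ≡⟨ +-identityʳ _ ⟩
  2 ^ ∣ ∁ q ∣ ∎
  where open ≡-Reasoning
∑-disj {n = suc n} (outside ∷ q) = trans
  (∑-cartesianProductWith (λ p → disj p (outside ∷ q)) _∷_ (outside ∷ inside ∷ []) (subsets n))
  (cong (λ a → a + (a + 0)) (∑-disj q))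

unique-family-disj : ∀ {G : List (Subset n)} → Unique G → ∀ q → (∑[ p ∈ G ] disj p q) ≤ 2 ^ ∣ ∁ q ∣
unique-family-disj uniq q = ≤-trans (∑-unique-≤ (λ p → disj p q) uniq (λ {p} _ → ∈-subsets p)) (≤-reflexive (∑-disj q))

unique-family-length : ∀ {G : List (Subset n)} → Unique G → length G ≤ 2 ^ n
unique-family-length {n} {G} uniq = begin
  length G                           ≡⟨ trans (sym (*-identityʳ _)) (sym (∑-const 1 G)) ⟩
  ∑ G (λ _ → 1)                      ≤⟨ ∑-unique-≤ (λ _ → 1) uniq (λ {p} _ → ∈-subsets p) ⟩
  ∑ (subsets n) (λ _ → 1)            ≡⟨ trans (∑-const 1 (subsets n)) (*-identityʳ _) ⟩
  length (subsets n)                 ≡⟨ length-subsets n ⟩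
  2 ^ n                              ∎
  where open ≤-Reasoning

-- Small unions are rare

⟦_⟧ : {P : Set} → Dec P → ℕ
⟦ yes _ ⟧ = 1
⟦ no  _ ⟧ = 0

small : ℕ → Subset n → ℕ
small {n} K u = ⟦ ∣ u ∣ * K ≤? n ⟧

module _ {n : ℕ} where
  open CliqueSums (disj {n}) disj-sym disj≤1
  open Unions _∪_ disj-∪

  -- The head y accumulates the union of the sets read so far. By `disj-∪` the remaining sets form a
  -- clique in the neighbourhood of that union.
  clique-∑∣∣ : ∀ y z → 1 ≤ clique (disj y) z → ∣ y ∣ + ∑ z ∣_∣ ≤ n
  clique-∑∣∣ y []      h = ≤-trans (≤-reflexive (+-identityʳ ∣ y ∣)) (∣p∣≤n y)
  clique-∑∣∣ y (x ∷ z) h with y⊥x , xz ← 1≤m*n⇒1≤m×1≤n {disj y x} h = begin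
    ∣ y ∣ + (∣ x ∣ + ∑ z ∣_∣)   ≡⟨ +-assoc ∣ y ∣ ∣ x ∣ _ ⟨
    ∣ y ∣ + ∣ x ∣ + ∑ z ∣_∣     ≡⟨ cong (_+ ∑ z ∣_∣) (1≤disj⇒∣∪∣ y x y⊥x) ⟩
    ∣ y ∪ x ∣ + ∑ z ∣_∣         ≤⟨ clique-∑∣∣ (y ∪ x) z (subst (1 ≤_) (clique-cong z (λ v → sym (disj-∪ y x v))) xz) ⟩
    n                           ∎
    where open ≤-Reasoning

  1≤clique⇒∑∣∣≤n : ∀ z → 1 ≤ clique (λ _ → 1) z → ∑ z ∣_∣ ≤ n
  1≤clique⇒∑∣∣≤n []      h = z≤n
  1≤clique⇒∑∣∣≤n (x ∷ z) h = clique-∑∣∣ x z (subst (1 ≤_) (trans (*-identityˡ _) (clique-cong z (λ v → *-identityˡ (disj x v)))) h)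

  no-small⇒∑∣∣>n : ∀ K (z : List (Subset n)) → ∑ z (small K) ≡ 0 → length z * suc n ≤ (∑ z ∣_∣) * K
  no-small⇒∑∣∣>n K []      h = z≤n
  no-small⇒∑∣∣>n K (x ∷ z) h with ∣ x ∣ * K ≤? n
  no-small⇒∑∣∣>n K (x ∷ z) () | yes _
  ... | no big = ≤-trans (+-mono-≤ (≰⇒> big) (no-small⇒∑∣∣>n K z h)) (≤-reflexive (sym (*-distribʳ-+ K ∣ x ∣ _)))

  clique≤∑small : ∀ K .{{_ : NonZero K}} z → length z ≡ K → clique (λ _ → 1) z ≤ ∑ z (small K)
  clique≤∑small K z len with ∑ z (small K) in eq
  ... | suc _ = ≤-trans (clique≤1 z (λ _ → ≤-refl)) (s≤s z≤n)
  ... | zero with clique (λ _ → 1) z in ceq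
  ...   | zero  = z≤n
  -- If none of the K disjoint sets were small, then K (n + 1) would be at most K times their total
  -- size, which is at most n.
  ...   | suc c = contradiction (1≤clique⇒∑∣∣≤n z (subst (1 ≤_) (sym ceq) (s≤s z≤n))) (<⇒≱ (*-cancelˡ-≤ K (begin
    K * suc n            ≡⟨ cong (_* suc n) len ⟨
    length z * suc n     ≤⟨ no-small⇒∑∣∣>n K z eq ⟩
    (∑ z ∣_∣) * K        ≡⟨ *-comm _ K ⟩
    K * (∑ z ∣_∣)        ∎)))
    where open ≤-Reasoning

  small-power : ∀ K .{{_ : NonZero K}} τ (u : Subset n) → small K u * (2 ^ ∣ u ∣) ^ τ ≤ (2 ^ (n / K)) ^ τ
  small-power K τ u with ∣ u ∣ * K ≤? n
  ... | no  _ = z≤n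
  ... | yes h = ≤-trans (≤-reflexive (*-identityˡ _)) (^-monoˡ-≤ τ (^-monoʳ-≤ 2 (begin
    ∣ u ∣           ≡⟨ m*n/n≡m ∣ u ∣ K ⟨
    ∣ u ∣ * K / K   ≤⟨ /-monoˡ-≤ K h ⟩
    n / K           ∎)))
    where open ≤-Reasoning

  -- Union bound over the small set containing the union: there are at most 2^n choices, and each
  -- contains at most 2^(n/K) members of `G`. The small set is represented by its complement q,
  -- since being disjoint from q factorises over a union.
  small-unions : ∀ K .{{_ : NonZero K}} t {G} → Unique G →
    ∑ (products _∪_ t G) (small K) ≤ 2 ^ n * (2 ^ (n / K)) ^ suc t
  small-unions K t {G} uniq = begin
    ∑ P (small K)
      ≤⟨ ∑-mono covered P ⟩
    (∑[ u ∈ P ] ∑[ q ∈ S ] small K (∁ q) * disj u q)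
      ≡⟨ ∑-swap _ P S ⟩
    (∑[ q ∈ S ] ∑[ u ∈ P ] small K (∁ q) * disj u q)
      ≡⟨ ∑-cong (λ q → trans (∑-distribˡ (small K (∁ q)) _ P) (cong (small K (∁ q) *_) (unions-w q t G))) S ⟩
    (∑[ q ∈ S ] small K (∁ q) * (∑[ p ∈ G ] disj p q) ^ suc t)
      ≤⟨ ∑-mono (λ q → ≤-trans (*-monoʳ-≤ (small K (∁ q)) (^-monoˡ-≤ (suc t) (unique-family-disj uniq q)))
                               (small-power K (suc t) (∁ q))) S ⟩
    (∑[ q ∈ S ] (2 ^ (n / K)) ^ suc t)
      ≡⟨ trans (∑-const _ S) (cong (_* (2 ^ (n / K)) ^ suc t) (length-subsets n)) ⟩
    2 ^ n * (2 ^ (n / K)) ^ suc t ∎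
    where
    open ≤-Reasoning
    P = products _∪_ t G
    S = subsets n
    -- The summand q = ∁ u suffices.
    covered : ∀ u → small K u ≤ (∑[ q ∈ S ] small K (∁ q) * disj u q)
    covered u = ≤-trans
      (≤-reflexive (sym (trans (cong₂ (λ v d → small K v * d) (∁-involutive u) (disj-∁ u)) (*-identityʳ _))))
      (∈⇒≤∑ (λ q → small K (∁ q) * disj u q) (∈-subsets (∁ u)))

  -- The number of factors is τ = 2b. With δ = a/b, the power m^τ exceeds (2^(n/K))^τ by a factor at
  -- least 2^(2an) ≥ 2^(2n): one 2^n pays for the choice of the small set, the other for m ≤ 2^n.
  -- Raising everything to the power b K makes the exponents integral.
  small-unions-rare : ∀ a′ b′ K .{{_ : NonZero K}} {G : List (Subset n)} → Unique G →
    2 ^ ((suc b′ + suc a′ * K) * n) ≤ length G ^ (suc b′ * K) →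
    ∑ (products _∪_ (b′ + suc b′) G) (small K) * length G ≤ length G ^ (suc b′ + suc b′)
  small-unions-rare a′ b′ K {G} uniq large = ^-cancelˡ-≤ (b * K) {{m*n≢0 b K}} (begin
    (∑ (products _∪_ (b′ + suc b′) G) (small K) * m) ^ (b * K)
      ≤⟨ ^-monoˡ-≤ (b * K) (*-mono-≤ (small-unions K (b′ + suc b′) uniq) (unique-family-length uniq)) ⟩
    (2 ^ n * (2 ^ q) ^ τ * 2 ^ n) ^ (b * K)
      ≡⟨ cong (_^ (b * K)) exponents ⟩
    (2 ^ (n + q * τ + n)) ^ (b * K)
      ≡⟨ ^-*-assoc 2 (n + q * τ + n) (b * K) ⟩
    2 ^ ((n + q * τ + n) * (b * K))
      ≤⟨ ^-monoʳ-≤ 2 compare ⟩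
    2 ^ ((b + suc a′ * K) * n * τ)
      ≡⟨ ^-*-assoc 2 ((b + suc a′ * K) * n) τ ⟨
    (2 ^ ((b + suc a′ * K) * n)) ^ τ
      ≤⟨ ^-monoˡ-≤ τ large ⟩
    (m ^ (b * K)) ^ τ
      ≡⟨ ^-swap m (b * K) τ ⟩
    (m ^ τ) ^ (b * K) ∎)
    where
    open ≤-Reasoning
    b = suc b′
    τ = b + b
    q = n / K
    m = length G
    exponents : 2 ^ n * (2 ^ q) ^ τ * 2 ^ n ≡ 2 ^ (n + q * τ + n)
    exponents = trans (cong (λ u → 2 ^ n * u * 2 ^ n) (^-*-assoc 2 q τ))
                (trans (cong (_* 2 ^ n) (sym (^-distribˡ-+-* 2 n (q * τ)))) (sym (^-distribˡ-+-* 2 (n + q * τ) n)))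
    expand : ∀ n q b K → (n + q * (b + b) + n) * (b * K) ≡ q * K * (b + b) * b + n * (b + b) * K
    expand = solve-∀
    collect : ∀ n a b K → n * (b + b) * b + n * (b + b) * K + a * (n * (b + b) * K) ≡ (b + (1 + a) * K) * n * (b + b)
    collect = solve-∀
    compare : (n + q * τ + n) * (b * K) ≤ (b + suc a′ * K) * n * τ
    compare = begin
      (n + q * τ + n) * (b * K)              ≡⟨ expand n q b K ⟩
      q * K * τ * b + n * τ * K              ≤⟨ +-monoˡ-≤ (n * τ * K) (*-monoˡ-≤ b (*-monoˡ-≤ τ (m/n*n≤m n K))) ⟩
      n * τ * b + n * τ * K                  ≤⟨ m≤m+n _ (a′ * (n * τ * K)) ⟩
      n * τ * b + n * τ * K + a′ * (n * τ * K) ≡⟨ collect n a′ b K ⟩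
      (b + suc a′ * K) * n * τ               ∎

  -- A clique has a small union in one of its K positions, and in each position at most a 1/m
  -- fraction of the unions is small.
  clique-unions-rare : ∀ a′ b′ K .{{_ : NonZero K}} {G : List (Subset n)} .{{_ : NonZero (length G)}} → Unique G →
    2 ^ ((suc b′ + suc a′ * K) * n) ≤ length G ^ (suc b′ * K) →
    T (products _∪_ (b′ + suc b′) G) K (λ _ → 1) * length G ≤ K * (length G ^ (suc b′ + suc b′)) ^ K
  clique-unions-rare a′ b′ K {G} uniq large = *-cancelˡ-≤ (m ^ τ) {{m^n≢0 m τ}} (begin
    m ^ τ * (T P K (λ _ → 1) * m)
      ≡⟨ trans (sym (*-assoc (m ^ τ) (T P K (λ _ → 1)) m))
               (cong₂ (λ u v → u * v * m) (sym (length-products _∪_ (b′ + suc b′) G)) (T≡∑clique P K (λ _ → 1))) ⟩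
    length P * ∑ (tuples K P) (clique (λ _ → 1)) * m
      ≤⟨ *-monoˡ-≤ m (*-monoʳ-≤ (length P)
           (∑-mono-All (All.map (λ {z} → clique≤∑small K z) (tuples-length K P)))) ⟩
    length P * (∑[ z ∈ tuples K P ] ∑ z (small K)) * m
      ≡⟨ cong (_* m) (∑-entries (small K) K P) ⟩
    K * length P ^ K * ∑ P (small K) * m
      ≡⟨ *-assoc (K * length P ^ K) (∑ P (small K)) m ⟩
    K * length P ^ K * (∑ P (small K) * m)
      ≤⟨ *-monoʳ-≤ (K * length P ^ K) (small-unions-rare a′ b′ K uniq large) ⟩
    K * length P ^ K * m ^ τ
      ≡⟨ trans (*-comm _ (m ^ τ)) (cong (λ u → m ^ τ * (K * u ^ K)) (length-products _∪_ (b′ + suc b′) G)) ⟩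
    m ^ τ * (K * (m ^ τ) ^ K) ∎)
    where
    open ≤-Reasoning
    τ = suc b′ + suc b′
    m = length G
    P = products _∪_ (b′ + suc b′) G

  -- The (k+1)-cliques are rare

  -- A clique density above 1/H would become a density at least H^(-e) among the unions, with e =
  -- τ^K, while only K/m is available there. This is the source of the threshold K H^e < m.
  cliques-rare : ∀ a′ b′ K .{{_ : NonZero K}} H {G : List (Subset n)} → Unique G →
    K * H ^ ((suc b′ + suc b′) ^ K) < length G →
    2 ^ ((suc b′ + suc a′ * K) * n) ≤ length G ^ (suc b′ * K) →
    H * T G K (λ _ → 1) ≤ length G ^ K
  cliques-rare a′ b′ K H {G@(_ ∷ _)} uniq many large = ≮⇒≥ λ dense → <⇒≱ many (*-cancelˡ-≤ (x ^ e) {{m^n≢0 x e {{>-nonZero (x>0 dense)}}}} (begin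
    x ^ e * m                 ≤⟨ *-cancelʳ-≤ _ _ (Z ^ K) {{m^n≢0 Z K {{m^n≢0 m τ}}}} rare ⟩
    (m ^ K) ^ e * K           ≤⟨ *-monoˡ-≤ K (^-monoˡ-≤ e (<⇒≤ dense)) ⟩
    (H * x) ^ e * K           ≡⟨ cong (_* K) (^-distribʳ-* e H x) ⟩
    H ^ e * x ^ e * K         ≡⟨ rotate (H ^ e) (x ^ e) K ⟩
    x ^ e * (K * H ^ e)       ∎))
    where
    open ≤-Reasoning
    τ = suc b′ + suc b′
    e = τ ^ K
    m = length G
    Z = m ^ τ
    x = T G K (λ _ → 1)
    x>0 : m ^ K < H * x → 0 < x
    x>0 dense = n≢0⇒n>0 λ x≡0 → contradiction (subst (λ u → m ^ K < H * u) x≡0 dense)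
                                              (λ h → n≮0 (subst (m ^ K <_) (*-zeroʳ H) h))
    rotate : ∀ a b c → a * b * c ≡ b * (c * a)
    rotate = solve-∀
    swap : ∀ a b c → a * b * c ≡ a * c * b
    swap = solve-∀
    P = products _∪_ (b′ + suc b′) G
    rare : x ^ e * m * Z ^ K ≤ (m ^ K) ^ e * K * Z ^ K
    rare = begin
      x ^ e * m * Z ^ K                        ≡⟨ swap (x ^ e) m (Z ^ K) ⟩
      x ^ e * Z ^ K * m                        ≤⟨ *-monoˡ-≤ m (blow-up (b′ + suc b′) K G (λ _ _ → ≤-refl) (λ _ → ≤-refl)) ⟩
      (m ^ K) ^ e * T P K (λ _ → 1) * m        ≡⟨ *-assoc ((m ^ K) ^ e) (T P K (λ _ → 1)) m ⟩
      (m ^ K) ^ e * (T P K (λ _ → 1) * m)      ≤⟨ *-monoʳ-≤ ((m ^ K) ^ e) (clique-unions-rare a′ b′ K uniq large) ⟩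
      (m ^ K) ^ e * (K * Z ^ K)                ≡⟨ *-assoc ((m ^ K) ^ e) K (Z ^ K) ⟨
      (m ^ K) ^ e * K * Z ^ K                  ∎

  disjointTuples-≤-T : ∀ k G → disjointTuples k G * k ! ≤ T G k (λ _ → 1)
  disjointTuples-≤-T k G = ≤-trans
    (*-monoˡ-≤ (k !) (length-filter-≤-∑ (AllPairs.allPairs? disjoint?)
      (λ {z} → 1≤clique (λ {p} {q} → Disjoint⇒1≤disj {p = p} {q}) (All.universal (λ _ → ≤-refl) z)) (combinations k G)))
    (combinations-≤-T k G (λ _ → 1))

  clique-log-convex : ∀ G s →
    suc s * T G (suc s) (λ _ → 1) ^ 2
      ≤ T G s (λ _ → 1) * (s * T G (suc (suc s)) (λ _ → 1) + length G * T G (suc s) (λ _ → 1))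
  clique-log-convex G s = subst (λ m → suc s * T G (suc s) (λ _ → 1) ^ 2
      ≤ T G s (λ _ → 1) * (s * T G (suc (suc s)) (λ _ → 1) + m * T G (suc s) (λ _ → 1)))
    (trans (∑-const 1 G) (*-identityʳ (length G))) (moon-moser G s (λ _ → 1))

-- Ratios of consecutive clique counts

module Ratio (t : ℕ → ℕ) (m : ℕ)
             (log-convex : ∀ s → suc s * t (suc s) ^ 2 ≤ t s * (s * t (suc (suc s)) + m * t (suc s))) where

  -- The case x = 0 is trivial, so the clique counts may be cancelled without knowing that they are
  -- positive.
  cancel-square : ∀ x y z → x ^ 2 * y ≤ z * x → x * y ≤ z
  cancel-square zero      y z _ = z≤n
  cancel-square x@(suc _) y z h = *-cancelˡ-≤ x (subst₂ _≤_ (expand x y) (*-comm z x) h)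
    where
    expand : ∀ x y → x * (x * 1) * y ≡ x * (x * y)
    expand = solve-∀

  -- For D → ∞ this is t (s+1) / t s ≤ m (j+1)/(j+s+1); the induction runs downwards in s.
  ratio : ∀ D k′ → D * t (2 + k′) ≤ m * t (suc k′) → ∀ j s → s + j ≡ k′ →
    suc k′ * D * t (suc s) ≤ suc j * (D + suc k′) * m * t s
  ratio D k′ base zero s eq rewrite sym (trans (sym eq) (+-identityʳ s)) = begin
    suc k′ * D * x    ≡⟨ *-comm (suc k′ * D) x ⟩
    x * (suc k′ * D)  ≤⟨ cancel-square x (suc k′ * D) (y * (D + k′) * m) (begin
      x ^ 2 * (suc k′ * D)               ≡⟨ shuffle₁ (x ^ 2) (suc k′) D ⟩
      suc k′ * x ^ 2 * D                 ≤⟨ *-monoˡ-≤ D (log-convex k′) ⟩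
      y * (k′ * t (2 + k′) + m * x) * D  ≡⟨ shuffle₂ y k′ (t (2 + k′)) m x D ⟩
      y * (k′ * (D * t (2 + k′)) + m * x * D) ≤⟨ *-monoʳ-≤ y (+-monoˡ-≤ (m * x * D) (*-monoʳ-≤ k′ base)) ⟩
      y * (k′ * (m * x) + m * x * D)     ≡⟨ shuffle₃ y k′ m x D ⟩
      y * (D + k′) * m * x               ∎) ⟩
    y * (D + k′) * m                ≤⟨ *-monoˡ-≤ m (*-monoʳ-≤ y (+-monoʳ-≤ D (n≤1+n k′))) ⟩
    y * (D + suc k′) * m            ≡⟨ shuffle₄ y (D + suc k′) m ⟩
    1 * (D + suc k′) * m * y        ∎
    where
    open ≤-Reasoning
    x = t (suc k′)
    y = t k′
    shuffle₁ : ∀ x k d → x * (k * d) ≡ k * x * d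
    shuffle₁ = solve-∀
    shuffle₂ : ∀ y k z m x d → y * (k * z + m * x) * d ≡ y * (k * (d * z) + m * x * d)
    shuffle₂ = solve-∀
    shuffle₃ : ∀ y k m x d → y * (k * (m * x) + m * x * d) ≡ y * (d + k) * m * x
    shuffle₃ = solve-∀
    shuffle₄ : ∀ y e m → y * e * m ≡ 1 * e * m * y
    shuffle₄ = solve-∀
  ratio D k′ base (suc j) s refl = *-cancelˡ-≤ (suc s) (begin
    suc s * (suc k′ * D * x)          ≡⟨ shuffle₀ (suc s) (suc k′ * D) x ⟩
    x * (suc s * (suc k′ * D))        ≤⟨ cancel-square x _ (y * (m * (s * (suc j * E) + suc k′ * E))) (begin
      x ^ 2 * (suc s * (suc k′ * D))                       ≡⟨ shuffle₁ (x ^ 2) (suc s) (suc k′ * D) ⟩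
      suc s * x ^ 2 * (suc k′ * D)                         ≤⟨ *-monoˡ-≤ (suc k′ * D) (log-convex s) ⟩
      y * (s * z + m * x) * (suc k′ * D)                   ≡⟨ shuffle₂ y s z m x (suc k′ * D) ⟩
      y * (s * (suc k′ * D * z) + m * x * (suc k′ * D))
        ≤⟨ *-monoʳ-≤ y (+-mono-≤ (*-monoʳ-≤ s (ratio D k′ base j (suc s) (sym (+-suc s j))))
                                 (*-monoʳ-≤ (m * x) (*-monoʳ-≤ (suc k′) (m≤m+n D (suc k′))))) ⟩
      y * (s * (suc j * E * m * x) + m * x * (suc k′ * E)) ≡⟨ shuffle₃ y s (suc j * E) m x (suc k′ * E) ⟩
      y * (m * (s * (suc j * E) + suc k′ * E)) * x         ∎) ⟩
    -- Here k′ + 1 = s + j + 2, and s (j + 1) + (s + j + 2) = (s + 1)(j + 2).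
    y * (m * (s * (suc j * E) + suc k′ * E)) ≡⟨ shuffle₄ s j y m E ⟩
    suc s * (suc (suc j) * E * m * y)        ∎)
    where
    open ≤-Reasoning
    E = D + suc k′
    x = t (suc s)
    y = t s
    z = t (suc (suc s))
    shuffle₀ : ∀ s k x → s * (k * x) ≡ x * (s * k)
    shuffle₀ = solve-∀
    shuffle₁ : ∀ x k d → x * (k * d) ≡ k * x * d
    shuffle₁ = solve-∀
    shuffle₂ : ∀ y s z m x d → y * (s * z + m * x) * d ≡ y * (s * (d * z) + m * x * d)
    shuffle₂ = solve-∀
    shuffle₃ : ∀ y s j m x e → y * (s * (j * m * x) + m * x * e) ≡ y * (m * (s * j + e)) * x
    shuffle₃ = solve-∀
    shuffle₄ : ∀ s j y m e → y * (m * (s * ((1 + j) * e) + (1 + (s + (1 + j))) * e)) ≡ (1 + s) * ((2 + j) * e * m * y)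
    shuffle₄ = solve-∀

  -- The numerators j + 1 of the successive ratios multiply to (k′ + 1)!/j!, whose denominator is
  -- kept on the left.
  telescope : ∀ D k′ → t 0 ≡ 1 → D * t (2 + k′) ≤ m * t (suc k′) → ∀ s j → s + j ≡ suc k′ →
    (suc k′ * D) ^ s * t s * j ! ≤ suc k′ ! * ((D + suc k′) * m) ^ s
  telescope D k′ t0≡1 base zero    j refl rewrite t0≡1 = ≤-reflexive (*-comm 1 (suc k′ !))
  telescope D k′ t0≡1 base (suc s) j eq = begin
    P * P ^ s * t (suc s) * j !              ≡⟨ shuffle₁ P (P ^ s) (t (suc s)) (j !) ⟩
    P ^ s * (P * t (suc s)) * j !            ≤⟨ *-monoˡ-≤ (j !) (*-monoʳ-≤ (P ^ s) (ratio D k′ base j s (suc-injective eq))) ⟩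
    P ^ s * (suc j * E * m * t s) * j !      ≡⟨ shuffle₂ (P ^ s) (suc j) E m (t s) (j !) ⟩
    P ^ s * t s * (suc j * j !) * (E * m)    ≤⟨ *-monoˡ-≤ (E * m) (telescope D k′ t0≡1 base s (suc j) (trans (+-suc s j) eq)) ⟩
    suc k′ ! * (E * m) ^ s * (E * m)         ≡⟨ trans (*-assoc (suc k′ !) _ (E * m)) (cong (suc k′ ! *_) (*-comm ((E * m) ^ s) (E * m))) ⟩
    suc k′ ! * (E * m) ^ suc s               ∎
    where
    open ≤-Reasoning
    P = suc k′ * D
    E = D + suc k′
    shuffle₁ : ∀ p q x f → p * q * x * f ≡ q * (p * x) * f
    shuffle₁ = solve-∀
    shuffle₂ : ∀ q j e m x f → q * (j * e * m * x) * f ≡ q * x * (j * f) * (e * m)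
    shuffle₂ = solve-∀

  sparse-bound : ∀ D k′ → t 0 ≡ 1 → D * t (2 + k′) ≤ m * t (suc k′) →
    (suc k′ * D) ^ suc k′ * t (suc k′) ≤ suc k′ ! * ((D + suc k′) * m) ^ suc k′
  sparse-bound D k′ t0≡1 base =
    ≤-trans (≤-reflexive (sym (*-identityʳ _))) (telescope D k′ t0≡1 base (suc k′) 0 (+-identityʳ (suc k′)))

-- Error constants and the bound on the k-clique density

-- The choice Q = 3 x makes (1 + 1/Q)² ≤ 1 + 1/x.
error-bound : ∀ x → x * suc (3 * x) ^ 2 ≤ suc x * (3 * x) ^ 2
error-bound zero    = z≤n
error-bound x@(suc y) = ≤-trans (m≤m+n _ (x * (3 * y + 2))) (≤-reflexive (expand y))
  where
  expand : ∀ y → (1 + y) * ((1 + 3 * (1 + y)) * ((1 + 3 * (1 + y)) * 1)) + (1 + y) * (3 * y + 2) ≡ (2 + y) * (3 * (1 + y) * (3 * (1 + y) * 1))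
  expand = solve-∀

module Density (t : ℕ → ℕ) (m : ℕ) (t0≡1 : t 0 ≡ 1)
               (log-convex : ∀ s → suc s * t (suc s) ^ 2 ≤ t s * (s * t (suc (suc s)) + m * t (suc s))) where
  open Ratio t m log-convex

  -- Either t (k+1) / t k ≤ m / D, and the ratio bounds apply, or t k itself is at most m^k / (2 d).
  density : ∀ k′ d′ P .{{_ : NonZero m}} →
    let k = suc k′; d = suc d′; Q = 3 * (k ! * d); D = k * k * suc Q in
    D * (2 * d) * t (suc k) ≤ m ^ suc k → m ^ k * Q ≤ P * suc Q →
    t k * k ^ k * d ≤ (k ! * d + k ^ k) * P
  density k′ d′ P rare mQ with D * t (suc k) ≤? m * t k
    where
    k = suc k′
    D = k * k * suc (3 * (k ! * suc d′))
  ... | yes base = *-cancelʳ-≤ _ _ (Q ^ 2) {{m^n≢0 Q 2 {{Q≢0}}}} (*-cancelˡ-≤ (D ^ k) {{m^n≢0 D k}} (begin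
    D ^ k * (x * k ^ k * d * Q ^ 2)
      ≡⟨ shuffle₁ (D ^ k) x (k ^ k) d Q ⟩
    k ^ k * D ^ k * x * (d * Q * Q)
      ≡⟨ cong (λ u → u * x * (d * Q * Q)) (^-distribʳ-* k k D) ⟨
    (k * D) ^ k * x * (d * Q * Q)
      ≤⟨ *-monoˡ-≤ (d * Q * Q) (sparse-bound D k′ t0≡1 base) ⟩
    k ! * ((D + k) * m) ^ k * (d * Q * Q)
      ≡⟨ cong (λ u → k ! * u * (d * Q * Q)) (^-distribʳ-* k (D + k) m) ⟩
    k ! * ((D + k) ^ k * m ^ k) * (d * Q * Q)
      ≡⟨ shuffle₂ (k !) ((D + k) ^ k) (m ^ k) d Q ⟩
    -- `D` = k² (Q + 1) is just what `power-ratio` asks for, so (1 + k/D)^k costs at most a factor 1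
    -- + 1/Q. Passing from m^k to `P` costs another such factor.
    k ! * d * (((D + k) ^ k * Q) * (m ^ k * Q))
      ≤⟨ *-monoʳ-≤ (k ! * d) (*-mono-≤ (power-ratio k D k Q (m≤m+n D k)) mQ) ⟩
    k ! * d * (D ^ k * suc Q * (P * suc Q))
      ≡⟨ shuffle₃ (k ! * d) (D ^ k) (suc Q) P ⟩
    -- Together the two factors are at most 1 + 1/(k! d), which adds 1 to k! d, and 1 ≤ k^k.
    D ^ k * (k ! * d * suc Q ^ 2 * P)
      ≤⟨ *-monoʳ-≤ (D ^ k) (*-monoˡ-≤ P (error-bound (k ! * d))) ⟩
    D ^ k * (suc (k ! * d) * Q ^ 2 * P)
      ≤⟨ *-monoʳ-≤ (D ^ k) (*-monoˡ-≤ P (*-monoˡ-≤ (Q ^ 2)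
           (≤-trans (≤-reflexive (+-comm 1 (k ! * d))) (+-monoʳ-≤ (k ! * d) (m^n>0 k k))))) ⟩
    D ^ k * ((k ! * d + k ^ k) * Q ^ 2 * P)
      ≡⟨ cong (D ^ k *_) (swap (k ! * d + k ^ k) (Q ^ 2) P) ⟩
    D ^ k * ((k ! * d + k ^ k) * P * Q ^ 2) ∎))
    where
    open ≤-Reasoning
    k = suc k′
    d = suc d′
    Q = 3 * (k ! * d)
    D = k * k * suc Q
    x = t k
    Q≢0 : NonZero Q
    Q≢0 = m*n≢0 3 (k ! * d) {{_}} {{m*n≢0 (k !) d {{k !≢0}}}}
    shuffle₁ : ∀ D x k d Q → D * (x * k * d * (Q * (Q * 1))) ≡ k * D * x * (d * Q * Q)
    shuffle₁ = solve-∀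
    shuffle₂ : ∀ f e m d Q → f * (e * m) * (d * Q * Q) ≡ f * d * ((e * Q) * (m * Q))
    shuffle₂ = solve-∀
    shuffle₃ : ∀ f D r P → f * (D * r * (P * r)) ≡ D * (f * (r * (r * 1)) * P)
    shuffle₃ = solve-∀
    swap : ∀ a b c → a * b * c ≡ a * c * b
    swap = solve-∀
  ... | no ¬base = begin
    x * k ^ k * d                ≡⟨ swap x (k ^ k) d ⟩
    x * d * k ^ k                ≤⟨ *-monoˡ-≤ (k ^ k) xd≤P ⟩
    P * k ^ k                    ≡⟨ *-comm P (k ^ k) ⟩
    k ^ k * P                    ≤⟨ *-monoˡ-≤ P (m≤n+m (k ^ k) (k ! * d)) ⟩
    (k ! * d + k ^ k) * P        ∎
    where
    open ≤-Reasoning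
    k = suc k′
    d = suc d′
    Q = 3 * (k ! * d)
    D = k * k * suc Q
    x = t k
    Q≢0 : NonZero Q
    Q≢0 = m*n≢0 3 (k ! * d) {{_}} {{m*n≢0 (k !) d {{k !≢0}}}}
    swap : ∀ a b c → a * b * c ≡ a * c * b
    swap = solve-∀
    shuffle₁ : ∀ m x d → m * (x * (2 * d)) ≡ m * x * (2 * d)
    shuffle₁ = solve-∀
    double : ∀ Q P → P * (Q + Q) ≡ 2 * P * Q
    double = solve-∀
    shuffle₂ : ∀ x d → 2 * (x * d) ≡ x * (2 * d)
    shuffle₂ = solve-∀
    -- Here the crude bound 1 + 1/Q ≤ 2 is enough; the factor 2 in `rare` was put there to absorb
    -- it.
    m^k≤2P : m ^ k ≤ 2 * P
    m^k≤2P = *-cancelʳ-≤ (m ^ k) (2 * P) Q {{Q≢0}} (begin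
      m ^ k * Q       ≤⟨ mQ ⟩
      P * suc Q       ≤⟨ *-monoʳ-≤ P (+-monoˡ-≤ Q (n≢0⇒n>0 (≢-nonZero⁻¹ Q {{Q≢0}}))) ⟩
      P * (Q + Q)     ≡⟨ double Q P ⟩
      2 * P * Q       ∎)
    xd≤P : x * d ≤ P
    xd≤P = *-cancelˡ-≤ 2 (≤-trans (≤-reflexive (shuffle₂ x d)) (≤-trans (*-cancelˡ-≤ m (begin
      m * (x * (2 * d))          ≡⟨ shuffle₁ m x d ⟩
      m * x * (2 * d)            ≤⟨ *-monoˡ-≤ (2 * d) (<⇒≤ (≰⇒> ¬base)) ⟩
      D * t (suc k) * (2 * d)    ≡⟨ swap D (t (suc k)) (2 * d) ⟩
      D * (2 * d) * t (suc k)    ≤⟨ rare ⟩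
      m * m ^ k                  ∎)) m^k≤2P))

-- The encoding is k = k' + 1, n = n' + 1, δ = (a' + 1)/(b' + 1), ε = (c' + 1)/(d' + 1). Rational
-- values suffice because decreasing δ or ε only strengthens the claim. The lower bound on m is
-- raised to the power (b' + 1)(k + 1), and the conclusion is multiplied by k^k (d' + 1).
theorem3 : (k' a' b' c' d' : ℕ) →
    Σ ℕ λ M →
    (n' : ℕ) (G : List (Subset (suc n'))) →
    Unique G →
    M ≤ length G →
    2 ^ ((suc b' + suc a' * (suc k' + 1)) * suc n') ≤ length G ^ (suc b' * (suc k' + 1)) →
    disjointTuples (suc k') G * (suc k' ^ suc k') * suc d'
    ≤ ((suc k' !) * suc d' + suc c' * (suc k' ^ suc k')) * (length G C suc k')
-- The first summand makes (k+1)-cliques rarer than 1/H; the summand `D` brings the falling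
-- factorial k! C(m, k) within a factor 1 + 1/Q of m^k.
theorem3 k' a' b' c' d' = suc (K * H ^ e) + D , bound
  where
  open ≤-Reasoning
  k = suc k'
  K = suc k
  d = suc d'
  Q = 3 * (k ! * d)
  D = k * k * suc Q
  H = D * (2 * d)
  e = (suc b' + suc b') ^ K
  shuffle : ∀ u p d f → f * (u * p * d) ≡ u * f * p * d
  shuffle = solve-∀
  rotate : ∀ u c f → u * (c * f) ≡ f * (u * c)
  rotate = solve-∀
  bound : ∀ n' (G : List (Subset (suc n'))) → Unique G → suc (K * H ^ e) + D ≤ length G →
    2 ^ ((suc b' + suc a' * (suc k' + 1)) * suc n') ≤ length G ^ (suc b' * (suc k' + 1)) →
    disjointTuples k G * (k ^ k) * d ≤ ((k !) * d + suc c' * (k ^ k)) * (length G C k)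
  bound n' G uniq M≤m large = *-cancelˡ-≤ (k !) {{k !≢0}} (begin
    k ! * (disjointTuples k G * k ^ k * d)
      ≡⟨ shuffle (disjointTuples k G) (k ^ k) d (k !) ⟩
    disjointTuples k G * k ! * k ^ k * d
      ≤⟨ *-monoˡ-≤ d (*-monoˡ-≤ (k ^ k) (disjointTuples-≤-T k G)) ⟩
    T G k (λ _ → 1) * k ^ k * d
      ≤⟨ density k' d' P {{>-nonZero (≤-trans (s≤s {n = K * H ^ e + D} z≤n) M≤m)}} rare falling ⟩
    (k ! * d + k ^ k) * P
      ≤⟨ *-monoˡ-≤ P (+-monoʳ-≤ (k ! * d) (m≤m+n (k ^ k) (c' * k ^ k))) ⟩
    (k ! * d + suc c' * k ^ k) * P
      ≡⟨ rotate (k ! * d + suc c' * k ^ k) (m C k) (k !) ⟩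
    k ! * ((k ! * d + suc c' * k ^ k) * (m C k)) ∎)
    where
    open CliqueSums (disj {suc n'}) disj-sym disj≤1
    m = length G
    P = (m C k) * k !
    open Density (λ s → T G s (λ _ → 1)) m refl (clique-log-convex G)
    rare : H * T G K (λ _ → 1) ≤ m ^ K
    rare = cliques-rare a' b' K H uniq (≤-trans (m≤m+n (suc (K * H ^ e)) D) M≤m)
      (subst (λ K → 2 ^ ((suc b' + suc a' * K) * suc n') ≤ m ^ (suc b' * K)) (+-comm k 1) large)
    D≤m : D ≤ m
    D≤m = ≤-trans (m≤n+m D (suc (K * H ^ e))) M≤m
    k≤m : k ≤ m
    k≤m = ≤-trans (≤-trans (m≤m*n k k) (m≤m*n (k * k) (suc Q))) D≤m
    m-split : m ∸ k + k ≡ m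
    m-split = m∸n+n≡m k≤m
    falling : m ^ k * Q ≤ P * suc Q
    falling = begin
      m ^ k * Q               ≡⟨ cong (λ u → u ^ k * Q) m-split ⟨
      (m ∸ k + k) ^ k * Q     ≤⟨ power-ratio k (m ∸ k) k Q {{>-nonZero (≤-trans (s≤s z≤n) (m≤n+m k (m ∸ k)))}} (≤-trans D≤m (≤-reflexive (sym m-split))) ⟩
      (m ∸ k) ^ k * suc Q     ≤⟨ *-monoˡ-≤ (suc Q) ([n∸k]^k≤nCk*k! m k) ⟩
      P * suc Q               ∎
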